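{- Let $G$ be a chordal graph. Then $\mathrm{pc}_r(G,k)\in O\big(k\cdot(r2^k+r^2k^2)\big)$. That is, there exists an absolute constant $C>0$ such that for every chordal graph $G$, every positive integer $r$ and every integer $k$ with $1\le k\le |V(G)|$, one has $\mathrm{pc}_r(G,k)\le C\, k\,(r2^k+r^2k^2)$.
   Context: All graphs are finite, simple, loopless and undirected. $\mathrm{dist}(u,v)$ is the usual graph distance (number of edges of a shortest path, $+\infty$ if there is none). For an integer $r$, let $\mathrm{Cap}_r(\ell)=\ell$ if $\ell\le r$ and $\mathrm{Cap}_r(\ell)=+\infty$ otherwise. For $A\subseteq V(G)$ and $v\in V(G)$, the $r$-profile of $v$ with respect to $A$ is the function $p_r(v,A):A\to\mathbb N\cup\{+\infty\}$, $a\mapsto \mathrm{Cap}_r(\mathrm{dist}(a,v))$. Let $\mathrm{pc}_r(G,A)=\big|\{p_r(v,A): v\in V(G)\}\setminus\{a\mapsto+\infty\}\big|$ (the number of distinct $r$-profiles with respect to $A$, not counting the constant $+\infty$ profile), and let $\mathrm{pc}_r(G,k)=\max\{\mathrm{pc}_r(G,A): A\subseteq V(G), |A|=k\}$ (the $r$-profile complexity of $G$). A graph is chordal if it has no induced cycle of length at least $4$. -}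

module Defs where

open import Data.Bool.Base using (if_then_else_)
open import Data.Fin.Base using (Fin; toℕ)
import Data.Fin.Properties as Fin
open import Data.Fin.Subset using (Subset; inside; outside; _∈_; ∣_∣)
open import Data.Fin.Subset.Properties using (_∈?_)
open import Data.List.Base as List
  using (List; []; _∷_; allFin; cartesianProductWith; deduplicate; filter; head; length; upTo)
open import Data.List.Extrema.Nat using (max)
import Data.List.Membership.Propositional as List
open import Data.List.Membership.Propositional.Properties
  using (∈-allFin; ∈-cartesianProductWith⁺)
open import Data.List.Relation.Unary.Any as Any using (here; there)
open import Data.Nat.Base using (ℕ; zero; suc; _≤_)
open import Data.Nat.Properties as ℕ using (_≤?_)
open import Data.Product.Base using (∃; _×_; _,_)
open import Data.Sum.Base using (_⊎_)
open import Data.Vec.Base as Vec using (Vec; []; _∷_)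
open import Data.Vec.Relation.Unary.AllPairs using (allPairs?)
open import Data.Vec.Relation.Unary.Linked using (Linked; linked?)
open import Data.Vec.Relation.Unary.Unique.Propositional using (Unique)
open import Function.Definitions using (Injective)
open import Level using (0ℓ)
open import Relation.Binary.Core using (Rel)
open import Relation.Binary.Definitions as B using (Symmetric)
open import Relation.Binary.PropositionalEquality.Core using (_≡_; refl)
open import Relation.Nullary.Construct.Add.Supremum using (_⁺; ⊤⁺; [_]; ≡-dec)
open import Relation.Nullary.Decidable
  using (Dec; yes; no; does; map′; ¬?; _×-dec_)
open import Relation.Nullary.Negation using (¬_; contradiction-irr)
open import Relation.Unary as U using (Pred)

private
  variable
    A : Set
    n : ℕ

------------------------------------------------------------------------
-- Enumerating vectors

allVecs : List A → ∀ m → List (Vec A m)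
allVecs xs zero    = [] ∷ []
allVecs xs (suc m) = cartesianProductWith _∷_ xs (allVecs xs m)

∈-allVecs : {xs : List A} → (∀ x → x List.∈ xs) →
            ∀ {m} (v : Vec A m) → v List.∈ allVecs xs m
∈-allVecs all []      = here refl
∈-allVecs all (x ∷ v) = ∈-cartesianProductWith⁺ _∷_ (all x) (∈-allVecs all v)

anyVec? : ∀ {m} {P : Pred (Vec (Fin n) m) 0ℓ} → U.Decidable P → Dec (∃ P)
anyVec? {n} {m} P? =
  map′ Any.satisfied
       (λ (v , pv) → List.lose (∈-allVecs ∈-allFin v) pv)
       (Any.any? P? (allVecs (allFin n) m))

subsets : ∀ n → List (Subset n)
subsets = allVecs (inside ∷ outside ∷ [])

∈-subsets : (S : Subset n) → S List.∈ subsets n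
∈-subsets = ∈-allVecs λ { inside → here refl ; outside → there (here refl) }

------------------------------------------------------------------------
-- Finite simple graphs

-- Since the vertex set is finite, decidability of adjacency is no
-- restriction classically; it is what makes distances computable.

record Graph (n : ℕ) : Set₁ where
  infix 4 _~_ _~?_
  field
    _~_    : Rel (Fin n) 0ℓ
    _~?_   : B.Decidable _~_
    ~-sym  : Symmetric _~_
    ~-irr  : ∀ {u} → ¬ (u ~ u)

ℕ∞ : Set
ℕ∞ = ℕ ⁺

pattern ∞ = ⊤⁺

infix 4 _≟∞_
_≟∞_ : B.DecidableEquality ℕ∞
_≟∞_ = ≡-dec ℕ._≟_

-- Next i j : j follows i in the cyclic order 0, 1, …, m ∸ 1, 0.
Next : ∀ {m} → Rel (Fin m) 0ℓ
Next {m} i j = suc (toℕ i) ≡ toℕ j ⊎ (suc (toℕ i) ≡ m × toℕ j ≡ 0)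

module _ (G : Graph n) where
  open Graph G

  record IsInducedCycle {m} (c : Fin m → Fin n) : Set where
    field
      distinct  : Injective _≡_ _≡_ c
      edges     : ∀ {i j} → Next i j → c i ~ c j
      chordless : ∀ {i j} → c i ~ c j → Next i j ⊎ Next j i

  Chordal : Set
  Chordal = ∀ {m} → 4 ≤ m → (c : Fin m → Fin n) → ¬ IsInducedCycle c

  -- A path with ℓ edges is listed by its suc ℓ vertices.
  Path : Fin n → Fin n → ℕ → Set
  Path u v ℓ = ∃ λ (p : Vec (Fin n) (suc ℓ)) →
    Vec.head p ≡ u × Vec.last p ≡ v × Linked _~_ p × Unique p

  path? : ∀ u v → U.Decidable (Path u v)
  path? u v ℓ = anyVec? λ p →
    (Vec.head p Fin.≟ u) ×-dec (Vec.last p Fin.≟ v) ×-dec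
    linked? _~?_ p ×-dec allPairs? (λ x y → ¬? (x Fin.≟ y)) p

  -- The candidate lengths 0, 1, …, n ∸ 1 are listed in increasing order,
  -- and a path has at most n vertices, hence fewer than n edges.
  dist : Fin n → Fin n → ℕ∞
  dist u v = head (filter (path? u v) (upTo n))

------------------------------------------------------------------------
-- Profiles

Cap : ℕ → ℕ∞ → ℕ∞
Cap r [ ℓ ] = if does (ℓ ≤? r) then [ ℓ ] else ∞
Cap r ∞     = ∞

Profile : Subset n → Set
Profile {n} A = (a : Fin n) → .(a ∈ A) → ℕ∞

infix 4 _≈_ _≈?_

_≈_ : {A : Subset n} → Rel (Profile A) 0ℓ
_≈_ {n} {A} p q = ∀ a .(a∈A : a ∈ A) → p a a∈A ≡ q a a∈A

_≈?_ : {A : Subset n} → B.Decidable (_≈_ {A = A})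
_≈?_ {n} {A} p q = Fin.all? agree?
  where
  agree? : ∀ a → Dec (.(a∈A : a ∈ A) → p a a∈A ≡ q a a∈A)
  agree? a with a ∈? A
  ... | yes a∈A = map′ (λ eq _ → eq) (λ f → f a∈A) (p a a∈A ≟∞ q a a∈A)
  ... | no  a∉A = yes λ a∈A → contradiction-irr a∈A a∉A

const∞ : {A : Subset n} → Profile A
const∞ _ _ = ∞

module _ (r : ℕ) (G : Graph n) where

  profile : Fin n → (A : Subset n) → Profile A
  profile v A a _ = Cap r (dist G a v)

  profileCount : Subset n → ℕ
  profileCount A =
    length (deduplicate _≈?_
      (filter (λ p → ¬? (p ≈? const∞))
        (List.map (λ v → profile v A) (allFin n))))

  -- The seed 0 only matters when there is no subset of size k, that is,
  -- when k exceeds n.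
  profileComplexity : ℕ → ℕ
  profileComplexity k =
    max 0 (List.map profileCount (filter (λ A → ∣ A ∣ ℕ.≟ k) (subsets n)))

{-# OPTIONS --safe #-}
module Submission where

-- A maximum cardinality search of a chordal graph yields a forest order on the
-- vertices in which the bag of w, i.e. w and its neighbours above it, is a
-- clique separating the subtree of w from the rest.  Group the vertices above
-- some element of A by the set of elements of A below them; there are at most
-- 2k classes, each a path from a bottom m up to a top t.  Attach a vertex v to
-- its lowest ancestor w above some element of A, and let d be its distance to
-- the bag of w, S the set of nearest vertices in it, and x and y the distances
-- from S to the bags of m and t.  The distance of v to a ∈ A is d + x or d + y
-- (according to whether a is below m), plus a constant of the class, plus 0 or
-- 1, and x + y is determined up to six values.  If x = 0 or y = 0, the k bits
-- are arbitrary, which gives O(r 2^k) profiles.  If x ≠ 0, then the distances to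
-- the elements below m are determined by how far down S reaches; hence for
-- given d and x their bits form a chain and are determined by their number.  The
-- same holds for y and the other elements, which gives O(r² k²) profiles.
--
-- Since the inequality to be proved is decidable, the argument runs in the
-- double negation monad.

open import Defs
open import Data.Bool.Base using (if_then_else_)
open import Data.Empty using (⊥)
open import Data.Fin.Base using (Fin; zero; suc; toℕ; fromℕ<; funToFin; finToFun)
import Data.Fin.Base as Fin
import Data.Fin.Properties as Fin
open import Data.Fin.Subset using (Subset; inside; outside; ∣_∣)
import Data.Fin.Subset as Subset
open import Data.Fin.Subset.Properties using (_∈?_)
open import Data.List.Base as List using (List; []; _∷_; allFin; filter; length)
open import Data.List.Extrema.Nat using (max≤v⁺)
open import Data.List.Membership.Propositional using (_∈_)
open import Data.List.Membership.Propositional.Properties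
  using (∈-allFin; ∈-deduplicate⁻; ∈-filter⁺; ∈-filter⁻; ∈-lookup; ∈-map⁻)
open import Data.List.Properties using (filter-notAll; length-filter)
import Data.List.Relation.Unary.All as ListAll
import Data.List.Relation.Unary.All.Properties as ListAll
open import Data.List.Relation.Unary.AllPairs using (AllPairs)
import Data.List.Relation.Unary.AllPairs as AllPairs
import Data.List.Relation.Unary.AllPairs.Properties as AllPairs
open import Data.List.Relation.Unary.Any as Any using (here; there)
open import Data.Maybe.Base using (fromMaybe; just; nothing)
open import Data.Nat.Base hiding (equal)
open import Data.Nat.Induction using (<-wellFounded)
open import Data.Nat.Properties
open import Data.Nat.Tactic.RingSolver using (solve-∀)
open import Data.Product.Base using (∃; ∃₂; _×_; _,_; proj₁; proj₂)
open import Data.Product.Function.NonDependent.Propositional using (_×-↔_)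
open import Data.Sum.Base using (_⊎_; inj₁; inj₂; [_,_]′)
open import Data.Sum.Function.Propositional using (_⊎-↔_)
open import Data.Vec.Base as Vec using (Vec; []; _∷_)
import Data.Vec.Relation.Unary.All as VecAll
open import Data.Vec.Relation.Unary.AllPairs using ([]; _∷_)
open import Data.Vec.Relation.Unary.Any as VecAny using (here; there)
open import Data.Vec.Relation.Unary.Linked using (Linked; [-]; _∷_)
open import Data.Vec.Relation.Unary.Unique.Propositional using (Unique)
open import Data.Vec.Relation.Unary.Unique.Propositional.Properties using (lookup-injective)
open import Function.Base using (_∘_; id)
open import Function.Bundles using (_↔_; Inverse)
open import Function.Properties.Inverse using (↔-refl; ↔-trans)
open import Induction.WellFounded using (Acc; acc)
open import Level using (0ℓ)
open import Relation.Binary.Core using (Rel)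
import Relation.Binary.Definitions as B
open import Relation.Binary.Definitions using (tri<; tri≈; tri>)
open import Relation.Binary.PropositionalEquality
  using (_≡_; _≢_; refl; sym; trans; cong; cong₂; subst; subst₂; module ≡-Reasoning)
open import Relation.Nullary.Construct.Add.Supremum using ([_])
open import Relation.Nullary.Decidable
  using (Dec; yes; no; _×-dec_; ¬?; recompute; decidable-stable; dec-false; ¬¬-excluded-middle)
open import Relation.Nullary.Negation using (¬_; contradiction)
open import Relation.Unary as U using (Pred)

private
  variable
    A B : Set
    n : ℕ

-- Double negation, extremal elements and filtered lists

infixl 1 _>>=_
_>>=_ : ¬ ¬ A → (A → ¬ ¬ B) → ¬ ¬ B
(x >>= f) k = x λ a → f a k

return : A → ¬ ¬ A
return x k = k x

em : ¬ ¬ Dec A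
em = ¬¬-excluded-middle

¬¬-choice : {P : Fin n → Set} → (∀ i → ¬ ¬ P i) → ¬ ¬ (∀ i → P i)
¬¬-choice {zero}  f = return λ ()
¬¬-choice {suc n} f = do
  p ← f zero
  q ← ¬¬-choice (f ∘ suc)
  return λ { zero → p ; (suc i) → q i }

IsMinimal : (A → ℕ) → (A → Set) → A → Set
IsMinimal f P x = P x × (∀ y → P y → f x ≤ f y)

IsMaximal : (A → ℕ) → (A → Set) → A → Set
IsMaximal f P x = P x × (∀ y → P y → f y ≤ f x)

minimal : (f : A → ℕ) {P : A → Set} → ∃ P → ¬ ¬ ∃ (IsMinimal f P)
minimal {A = A} f {P} (x , px) = go x px (<-wellFounded (f x))
  where
  go : ∀ x → P x → Acc _<_ (f x) → ¬ ¬ ∃ (IsMinimal f P)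
  go x px (acc rec) = do
    yes (y , py , y<x) ← em {A = ∃ λ y → P y × f y < f x}
      where no ∄ → return (x , px , λ y py → ≮⇒≥ λ y<x → ∄ (y , py , y<x))
    go y py (rec y<x)

maximal : (f : A → ℕ) (bound : ℕ) → (∀ x → f x ≤ bound) → {P : A → Set} → ∃ P → ¬ ¬ ∃ (IsMaximal f P)
maximal f bound f≤ ∃P = do
  (x , px , least) ← minimal (λ y → bound ∸ f y) ∃P
  return (x , px , λ y py → ∸-cancelʳ-≤ (f≤ y) (least y py))

length-filter-≤ : {P Q : Pred A 0ℓ} (P? : U.Decidable P) (Q? : U.Decidable Q) →
  (∀ x → P x → Q x) → ∀ xs → length (filter P? xs) ≤ length (filter Q? xs)
length-filter-≤ P? Q? P⊆Q []       = z≤n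
length-filter-≤ P? Q? P⊆Q (x ∷ xs) with P? x | Q? x
... | yes p | yes q = s≤s (length-filter-≤ P? Q? P⊆Q xs)
... | yes p | no ¬q = contradiction (P⊆Q x p) ¬q
... | no ¬p | yes q = m≤n⇒m≤1+n (length-filter-≤ P? Q? P⊆Q xs)
... | no ¬p | no ¬q = length-filter-≤ P? Q? P⊆Q xs

length-filter-< : {P Q : Pred A 0ℓ} (P? : U.Decidable P) (Q? : U.Decidable Q) →
  (∀ x → P x → Q x) → ∀ {y} → Q y → ¬ P y → ∀ {xs} → y ∈ xs →
  length (filter P? xs) < length (filter Q? xs)
length-filter-< P? Q? P⊆Q {y} qy ¬py {x ∷ xs} (here refl) with P? x | Q? x
... | yes p | _     = contradiction p ¬py
... | no _  | yes q = s≤s (length-filter-≤ P? Q? P⊆Q xs)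
... | no _  | no ¬q = contradiction qy ¬q
length-filter-< P? Q? P⊆Q {y} qy ¬py {x ∷ xs} (there y∈) with P? x | Q? x
... | yes p | yes q = s≤s (length-filter-< P? Q? P⊆Q qy ¬py y∈)
... | yes p | no ¬q = contradiction (P⊆Q x p) ¬q
... | no ¬p | yes q = m≤n⇒m≤1+n (length-filter-< P? Q? P⊆Q qy ¬py y∈)
... | no ¬p | no ¬q = length-filter-< P? Q? P⊆Q qy ¬py y∈

-- Induced cycles obtained by shortcutting

module Cycles (G : Graph n) where
  open Graph G

  V : Set
  V = Fin n

  ~⇒≢ : ∀ {u v} → u ~ v → u ≢ v
  ~⇒≢ u~u refl = ~-irr u~u

  -- The cycle q 0, …, q (2 + M) closes a path through Inner whose only
  -- neighbour of q (2 + M) is its last vertex, which misses q 0.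
  record LongCycle (Inner : V → Set) (M : ℕ) (q : ℕ → V) : Set where
    field
      step        : ∀ {i} → i < 2 + M → q i ~ q (suc i)
      close       : q (2 + M) ~ q 0
      inner       : ∀ {i} → 0 < i → i < 2 + M → Inner (q i)
      first-outer : ¬ Inner (q 0)
      last-outer  : ¬ Inner (q (2 + M))
      last-misses : ∀ {i} → 0 < i → i < 1 + M → ¬ (q i ~ q (2 + M))
      first-misses : ¬ (q (1 + M) ~ q 0)

  -- Chords at `q (2 + M)` are left out because `last-misses` excludes them already.
  Chord : ℕ → (ℕ → V) → Set
  Chord M q = ∃₂ λ a b → suc a < b × b < 2 + M × q a ~ q b

  -- The chord replaces the stretch between its ends. As `b < 2 + M`, the last two vertices survive,
  -- and with them the conditions at the end of the cycle.
  shortcut : ∀ {Inner M q} → LongCycle Inner M q → Chord M q →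
             ∃₂ λ M′ q′ → M′ < M × LongCycle Inner M′ q′
  shortcut {Inner} {M} {q} cyc (a , b , 1+a<b , b<2+M , qa~qb)
    with m≤n⇒∃[o]m+o≡n 1+a<b | m≤n⇒∃[o]m+o≡n b<2+M
  -- Here `b = 2 + a + g` and `M = suc (a + g + e)`, so `suc g` vertices are dropped.
  ... | g , refl | e , refl = a + e , q′ , s≤s (+-monoˡ-≤ e (m≤m+n a g)) , record
    { step = λ {i} → step′ i
    ; close = subst (_~ q 0) (sym (q′-last 1)) close
    ; inner = λ {i} → inner′ i
    ; first-outer = first-outer
    ; last-outer = last-outer ∘ subst Inner (q′-last 1)
    ; last-misses = λ {i} → last-misses′ i
    ; first-misses = first-misses ∘ subst (_~ q 0) (q′-last 0)
    }
    where
    open LongCycle cyc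

    q′ : ℕ → V
    q′ i with i ≤? a
    ... | yes _ = q i
    ... | no _  = q (i + suc g)

    q′≤ : ∀ {i} → i ≤ a → q′ i ≡ q i
    q′≤ {i} i≤a with i ≤? a
    ... | yes _ = refl
    ... | no i≰a = contradiction i≤a i≰a

    q′> : ∀ {i} → a < i → q′ i ≡ q (i + suc g)
    q′> {i} a<i with i ≤? a
    ... | yes i≤a = contradiction a<i (≤⇒≯ i≤a)
    ... | no _ = refl

    shift′ : ∀ a e g j → j + (a + e) + suc g ≡ j + suc (a + g + e)
    shift′ = solve-∀

    shift : ∀ j → j + (a + e) + suc g ≡ j + suc (a + g + e)
    shift = shift′ a e g

    q′-last : ∀ j → q′ (suc j + (a + e)) ≡ q (suc j + suc (a + g + e))
    q′-last j = trans (q′> (s≤s (≤-trans (m≤m+n a e) (m≤n+m _ j)))) (cong q (shift (suc j)))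

    shift-< : ∀ {i} j → i < j + (a + e) → i + suc g < j + suc (a + g + e)
    shift-< {i} j i< = subst (i + suc g <_) (shift j) (+-monoˡ-< (suc g) i<)

    unshift-< : ∀ {i} j → i < j + (a + e) → i < j + suc (a + g + e)
    unshift-< j i< = <-≤-trans i< (+-monoʳ-≤ j (m≤n⇒m≤1+n (+-monoˡ-≤ e (m≤m+n a g))))

    step′ : ∀ i → i < 2 + (a + e) → q′ i ~ q′ (suc i)
    step′ i i< with <-cmp i a
    ... | tri< i<a _ _ = subst₂ _~_ (sym (q′≤ (<⇒≤ i<a))) (sym (q′≤ i<a)) (step (unshift-< 2 i<))
    ... | tri≈ _ refl _ = subst₂ _~_ (sym (q′≤ ≤-refl)) (sym (trans (q′> ≤-refl) (cong q (cong suc (+-suc a g))))) qa~qb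
    ... | tri> _ _ i>a = subst₂ _~_ (sym (q′> i>a)) (sym (q′> (m≤n⇒m≤1+n i>a))) (step (shift-< 2 i<))

    inner′ : ∀ i → 0 < i → i < 2 + (a + e) → Inner (q′ i)
    inner′ i 0<i i< with i ≤? a
    ... | yes _ = inner 0<i (unshift-< 2 i<)
    ... | no _  = inner (≤-trans 0<i (m≤m+n i _)) (shift-< 2 i<)

    last-misses′ : ∀ i → 0 < i → i < 1 + (a + e) → ¬ (q′ i ~ q′ (2 + (a + e)))
    last-misses′ i 0<i i<
      rewrite q′-last 1 with i ≤? a
    ... | yes _ = last-misses 0<i (unshift-< 1 i<)
    ... | no _  = last-misses (≤-trans 0<i (m≤m+n i _)) (shift-< 1 i<)

  module _ {Inner : V → Set} {M : ℕ} {q : ℕ → V} (cyc : LongCycle Inner M q)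
           (chordless : ¬ Chord M q) where
    open LongCycle cyc

    no-far-edge : ∀ {i j} → suc i < j → j < 3 + M → q i ~ q j → i ≡ 0 × j ≡ 2 + M
    no-far-edge {i} {j} 1+i<j j<3+M qi~qj with m≤n⇒m<n∨m≡n (≤-pred j<3+M)
    ... | inj₁ j<2+M = contradiction (i , j , 1+i<j , j<2+M , qi~qj) chordless
    no-far-edge {zero}  _     _ _     | inj₂ refl = refl , refl
    no-far-edge {suc i} 1+i<j _ qi~qj | inj₂ refl =
      contradiction qi~qj (last-misses (s≤s z≤n) (≤-pred 1+i<j))

    -- If two inner vertices coincided, the edge into the first would be a chord to the second.
    -- `Inner` tells the two outer vertices from the inner ones, and the closing edge tells them
    -- from each other.
    no-repeat : ∀ {i j} → i < j → j < 3 + M → q i ≢ q j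
    no-repeat {zero} {j} 0<j j<3+M eq with m≤n⇒m<n∨m≡n (≤-pred j<3+M)
    ... | inj₁ j<2+M = first-outer (subst Inner (sym eq) (inner 0<j j<2+M))
    ... | inj₂ refl  = ~⇒≢ close (sym eq)
    no-repeat {suc i} {j} i<j j<3+M eq with m≤n⇒m<n∨m≡n (≤-pred j<3+M)
    ... | inj₁ j<2+M = chordless
          (i , j , i<j , j<2+M , subst (q i ~_) eq (step (<-trans (n<1+n i) (<-trans i<j j<2+M))))
    ... | inj₂ refl  = last-outer (subst Inner eq (inner (s≤s z≤n) i<j))

    inducedCycle : IsInducedCycle G (q ∘ toℕ {3 + M})
    inducedCycle = record
      { distinct = distinct _ _
      ; edges = edges _ _
      ; chordless = chordless′ _ _
      }
      where
      distinct : ∀ i j → q (toℕ {3 + M} i) ≡ q (toℕ j) → i ≡ j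
      distinct i j eq with <-cmp (toℕ i) (toℕ j)
      ... | tri< i<j _ _ = contradiction eq (no-repeat i<j (Fin.toℕ<n j))
      ... | tri≈ _ i≡j _ = Fin.toℕ-injective i≡j
      ... | tri> _ _ j<i = contradiction (sym eq) (no-repeat j<i (Fin.toℕ<n i))

      edges : ∀ (i j : Fin (3 + M)) → Next i j → q (toℕ i) ~ q (toℕ j)
      edges i j (inj₁ 1+i≡j) =
        subst (λ k → q (toℕ i) ~ q k) 1+i≡j
          (step (≤-pred (subst (_< 3 + M) (sym 1+i≡j) (Fin.toℕ<n j))))
      edges i j (inj₂ (1+i≡3+M , j≡0)) =
        subst₂ (λ k l → q k ~ q l) (suc-injective (sym 1+i≡3+M)) (sym j≡0) close

      forward : ∀ (i j : Fin (3 + M)) → toℕ i < toℕ j → q (toℕ i) ~ q (toℕ j) → Next i j ⊎ Next j i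
      forward i j i<j e with m≤n⇒m<n∨m≡n i<j
      ... | inj₂ 1+i≡j = inj₁ (inj₁ 1+i≡j)
      ... | inj₁ 1+i<j with no-far-edge 1+i<j (Fin.toℕ<n j) e
      ...   | i≡0 , j≡2+M = inj₂ (inj₂ (cong suc j≡2+M , i≡0))

      chordless′ : ∀ (i j : Fin (3 + M)) → q (toℕ i) ~ q (toℕ j) → Next i j ⊎ Next j i
      chordless′ i j e with <-cmp (toℕ i) (toℕ j)
      ... | tri< i<j _ _ = forward i j i<j e
      ... | tri≈ _ i≡j _ = contradiction (cong q i≡j) (~⇒≢ e)
      ... | tri> _ _ j<i = [ inj₂ , inj₁ ]′ (forward j i j<i (~-sym e))

  -- Shortcutting ends because `M` decreases. `first-misses` excludes `M = 0`, so the chordless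
  -- cycle that remains has at least four vertices.
  no-longCycle : Chordal G → ∀ {Inner M q} → ¬ LongCycle Inner M q
  no-longCycle chordal {Inner} {M} cyc = go cyc (<-wellFounded M)
    where
    go : ∀ {M q} → LongCycle Inner M q → Acc _<_ M → ⊥
    go {M} {q} cyc (acc rec) = em {A = Chord M q} λ
      { (yes chord) → let _ , _ , M′<M , cyc′ = shortcut cyc chord in go cyc′ (rec M′<M)
      ; (no ∄chord) → chordal (s≤s (s≤s (s≤s (1≤M cyc)))) _ (inducedCycle cyc ∄chord)
      }
      where
      1≤M : ∀ {M} → LongCycle Inner M q → 1 ≤ M
      1≤M {zero}  c = contradiction (~-sym (LongCycle.step c (s≤s z≤n))) (LongCycle.first-misses c)
      1≤M {suc _} c = s≤s z≤n

-- The elimination forest and maximum cardinality search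

module Reachability (G : Graph n) (pos : Fin n → ℕ) where
  open Graph G
  open Cycles G using (V)

  -- For an elimination order pos, Reach u v says that u is an ancestor of v in
  -- the elimination forest.
  data Reach (u : V) : V → Set where
    here : Reach u u
    step : ∀ {x y} → Reach u x → x ~ y → pos u ≤ pos y → Reach u y

  reach⇒≤ : ∀ {u v} → Reach u v → pos u ≤ pos v
  reach⇒≤ here           = ≤-refl
  reach⇒≤ (step _ _ u≤v) = u≤v

  edge : ∀ {u v} → pos u ≤ pos v → u ~ v → Reach u v
  edge u≤v u~v = step here u~v u≤v

  reach-trans : ∀ {u v w} → Reach u v → Reach v w → Reach u w
  reach-trans p here             = p
  reach-trans p (step q x~w v≤w) = step (reach-trans p q) x~w (≤-trans (reach⇒≤ p) v≤w)

  -- The path from `v` to `w` stays at positions at least `pos v`, hence at least `pos u`, so it can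
  -- be appended backwards to the path from `u`. This makes any two ancestors of a vertex
  -- comparable: the order is a forest.
  reach-join : ∀ {u v w} → Reach u w → Reach v w → pos u ≤ pos v → Reach u v
  reach-join p here             u≤v = p
  reach-join p (step q x~w v≤w) u≤v =
    reach-join (step p (~-sym x~w) (≤-trans u≤v (reach⇒≤ q))) q u≤v

module Elimination (G : Graph n) where
  open Graph G
  open Cycles G
  open Reachability G using (Reach; here; step; edge; reach⇒≤; reach-trans; reach-join)

  -- The vertices of position below m have been visited, in the order of
  -- their positions; the others all have position m.
  record Stage (m : ℕ) (pos : V → ℕ) : Set where
    field
      bounded    : ∀ v → pos v ≤ m
      injective  : ∀ {u v} → pos u < m → pos u ≡ pos v → u ≡ v
      simplicial : ∀ {u x w} → pos x < m → pos u < pos x → Reach pos x w → u ~ w → u ~ x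

  -- `simplicial` is the perfect elimination property, stated for a whole subtree at once: with
  -- `x ~ w` it says that the earlier neighbours of `w` form a clique.
  record IsElimination (pos : V → ℕ) : Set where
    field
      injective  : ∀ {u v} → pos u ≡ pos v → u ≡ v
      simplicial : ∀ {u x w} → pos u < pos x → Reach pos x w → u ~ w → u ~ x

  -- Becomes a `LongCycle` once a suitable vertex adjacent to both `x` and `s` is put in front.
  record Approach (Inner : V → Set) (x s : V) : Set where
    field
      {last}      : ℕ
      {q}         : ℕ → V
      start       : q 0 ≡ x
      end         : q (suc last) ≡ s
      inner       : ∀ {i} → i ≤ last → Inner (q i)
      edges       : ∀ {i} → i ≤ last → q i ~ q (suc i)
      last-misses : ∀ {i} → i < last → ¬ (q i ~ s)

  infixr 5 _◂_
  _◂_ : A → (ℕ → A) → ℕ → A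
  (x ◂ f) zero    = x
  (x ◂ f) (suc i) = f i

  module _ {m : ℕ} {pos : V → ℕ} (stage : Stage m pos) where
    open Stage stage

    Unvisited : V → Set
    Unvisited v = pos v ≡ m

    unvisited-reach : ∀ {u v} → Unvisited u → Reach pos u v → Unvisited v
    unvisited-reach refl p = ≤-antisym (bounded _) (reach⇒≤ pos p)

    -- The later visited of `s` and `t` is an ancestor of both `x` and `y`, so `simplicial` carries
    -- the edge of the earlier one into the component up to it.
    attachment-clique : ∀ {x y s t} → Unvisited x → Reach pos x y → pos s < m → pos t < m →
                        s ≢ t → s ~ x → t ~ y → s ~ t
    attachment-clique {x} {y} {s} {t} refl p s<m t<m s≢t s~x t~y with <-cmp (pos s) (pos t)
    ... | tri< s<t _ _ =
      simplicial t<m s<t (reach-join pos (edge pos (≤-trans (<⇒≤ t<m) (reach⇒≤ pos p)) t~y) p (<⇒≤ t<m)) s~x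
    ... | tri≈ _ s≡t _ = contradiction (injective s<m s≡t) s≢t
    ... | tri> _ _ t<s =
      ~-sym (simplicial s<m t<s (reach-trans pos (edge pos (<⇒≤ s<m) s~x) p) t~y)

    visitedNeighbour? : ∀ v → U.Decidable (λ s → pos s < m × s ~ v)
    visitedNeighbour? v s = (pos s <? m) ×-dec (s ~? v)

    label : V → ℕ
    label v = length (filter (visitedNeighbour? v) (allFin n))

    -- Follow the path from `x` back towards `w` and leave it at the first neighbour of `s`.
    approach : ∀ {w x s} → Unvisited w → Reach pos w x → w ~ s → Approach Unvisited x s
    approach {w} {s = s} unv here w~s = record
      { last = 0
      ; q = w ◂ λ _ → s
      ; start = refl
      ; end = refl
      ; inner = λ { z≤n → unv }
      ; edges = λ { z≤n → w~s }
      ; last-misses = λ ()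
      }
    approach {x = x} {s} unv p@(step {y} p′ y~x _) w~s with x ~? s
    ... | yes x~s = approach (unvisited-reach unv p) here x~s
    ... | no x≁s = record
      { q = x ◂ q
      ; start = refl
      ; end = end
      ; inner = λ { {zero} _ → unvisited-reach unv p ; {suc i} (s≤s i≤) → inner i≤ }
      ; edges = λ { {zero} _ → ~-sym (subst (_~ x) (sym start) y~x) ; {suc i} (s≤s i≤) → edges i≤ }
      ; last-misses = λ { {zero} _ → x≁s ; {suc i} (s≤s i<) → last-misses i< }
      }
      where open Approach (approach unv p′ w~s)

    -- Maximum cardinality search: an unvisited vertex with the most visited
    -- neighbours is adjacent to all visited neighbours of its component, for
    -- otherwise a long induced cycle appears.
    dominating : Chordal G → ∀ {c} → Unvisited c → (∀ v → Unvisited v → label v ≤ label c) →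
                 ∀ {w s} → Reach pos c w → pos s < m → s ~ w → s ~ c
    dominating chordal {c} unv most {w} {s} p s<m s~w = decidable-stable (s ~? c) missing
      where
      unv-w : Unvisited w
      unv-w = unvisited-reach unv p

      open Approach (approach unv-w (reach-join pos here p (≤-reflexive (trans unv-w (sym unv)))) (~-sym s~w))

      z : V
      z = q last

      z~s : z ~ s
      z~s = subst (z ~_) end (edges ≤-refl)

      reach-z : ∀ {i} → i ≤ last → Reach pos c (q i)
      reach-z {zero}  _  = subst (Reach pos c) (sym start) here
      reach-z {suc i} i< =
        step (reach-z (<⇒≤ i<)) (edges (<⇒≤ i<)) (≤-reflexive (trans unv (sym (inner i<))))

      missing : ¬ ¬ (s ~ c)
      -- A visited neighbour `t` of `c` that misses `z` closes the path from `c` over `z` to `s`,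
      -- since `s ~ t`. Without such a `t`, all visited neighbours of `c` are neighbours of `z`, and
      -- `s` is one more, so the label of `z` exceeds that of `c`.
      missing s≁c = em {A = ∃ λ t → pos t < m × t ~ c × ¬ (t ~ z)} λ
        { (yes (t , t<m , t~c , t≁z)) → no-longCycle chordal (cycle t<m t~c t≁z)
        ; (no ∄t) →
          <⇒≱ (length-filter-< (visitedNeighbour? c) (visitedNeighbour? z)
                (λ t (t<m , t~c) → t<m , decidable-stable (t ~? z) λ t≁z → ∄t (t , t<m , t~c , t≁z))
                (s<m , ~-sym z~s) (s≁c ∘ proj₂) (∈-allFin s))
              (most z (inner ≤-refl))
        }
        where
        cycle : ∀ {t} → pos t < m → t ~ c → ¬ (t ~ z) → LongCycle Unvisited last (t ◂ q)
        cycle {t} t<m t~c t≁z = record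
          { step = λ { {zero} _ → subst (t ~_) (sym start) t~c ; {suc i} (s≤s (s≤s i≤)) → edges i≤ }
          ; close = subst (_~ t) (sym end) s~t
          ; inner = λ { {suc i} _ (s≤s (s≤s i≤)) → inner i≤ }
          ; first-outer = <⇒≢ t<m
          ; last-outer = <⇒≢ s<m ∘ trans (cong pos (sym end))
          ; last-misses = λ { {suc i} _ (s≤s i<) → last-misses i< ∘ subst (q i ~_) end }
          ; first-misses = t≁z ∘ ~-sym
          }
          where
          s~t : s ~ t
          s~t = ~-sym (attachment-clique unv (reach-z ≤-refl) t<m s<m
            (λ { refl → t≁z (~-sym z~s) }) t~c (~-sym z~s))

    visit : V → V → ℕ
    visit c v with v Fin.≟ c | pos v <? m
    ... | yes _ | _     = pos v
    ... | no _  | yes _ = pos v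
    ... | no _  | no _  = suc m

    module _ {c : V} (unv : Unvisited c) where

      visit-new : visit c c ≡ m
      visit-new with c Fin.≟ c | pos c <? m
      ... | yes _ | _ = unv
      ... | no c≢c | _ = contradiction refl c≢c

      visit-cases : ∀ v → (pos v < m × visit c v ≡ pos v) ⊎ v ≡ c ⊎ (Unvisited v × v ≢ c × visit c v ≡ suc m)
      visit-cases v with v Fin.≟ c | pos v <? m
      ... | yes v≡c | _       = inj₂ (inj₁ v≡c)
      ... | no _    | yes v<m = inj₁ (v<m , refl)
      ... | no v≢c  | no v≮m  = inj₂ (inj₂ (≤-antisym (bounded v) (≮⇒≥ v≮m) , v≢c , refl))

      pos≤visit : ∀ v → pos v ≤ visit c v
      pos≤visit v with visit-cases v
      ... | inj₁ (_ , eq)              = ≤-reflexive (sym eq)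
      ... | inj₂ (inj₁ refl)           = ≤-reflexive (trans unv (sym visit-new))
      ... | inj₂ (inj₂ (v≡m , _ , eq)) = ≤-trans (m≤n⇒m≤1+n (≤-reflexive v≡m)) (≤-reflexive (sym eq))

      visit⇒pos-≤ : ∀ {u v} → visit c u ≡ pos u → visit c u ≤ visit c v → pos u ≤ pos v
      visit⇒pos-≤ {u} {v} eq u≤v with visit-cases v
      ... | inj₁ (_ , eq′)            = subst₂ _≤_ eq eq′ u≤v
      ... | inj₂ (inj₁ refl)          = ≤-trans (bounded u) (≤-reflexive (sym unv))
      ... | inj₂ (inj₂ (v≡m , _ , _)) = ≤-trans (bounded u) (≤-reflexive (sym v≡m))

      -- Visiting `c` only raises other unvisited vertices, so a path that starts at a vertex
      -- already in place was a path before.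
      visit⇒pos-reach : ∀ {u v} → visit c u ≡ pos u → Reach (visit c) u v → Reach pos u v
      visit⇒pos-reach eq here           = here
      visit⇒pos-reach eq (step p e u≤v) = step (visit⇒pos-reach eq p) e (visit⇒pos-≤ eq u≤v)

      visit-stage : Chordal G → (∀ v → Unvisited v → label v ≤ label c) → Stage (suc m) (visit c)
      visit-stage chordal most = record
        { bounded = bounded′
        ; injective = injective′ _ _
        ; simplicial = simplicial′ _ _
        }
        where
        bounded′ : ∀ v → visit c v ≤ suc m
        bounded′ v with visit-cases v
        ... | inj₁ (v<m , eq)          = ≤-trans (≤-reflexive eq) (m≤n⇒m≤1+n (bounded v))
        ... | inj₂ (inj₁ refl)         = ≤-trans (≤-reflexive visit-new) (n≤1+n m)
        ... | inj₂ (inj₂ (_ , _ , eq)) = ≤-reflexive eq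

        injective′ : ∀ u v → visit c u < suc m → visit c u ≡ visit c v → u ≡ v
        injective′ u v u<1+m eq with visit-cases u | visit-cases v
        ... | inj₂ (inj₂ (_ , _ , u≡)) | _ = contradiction u≡ (<⇒≢ u<1+m)
        ... | _ | inj₂ (inj₂ (_ , _ , v≡)) = contradiction (trans eq v≡) (<⇒≢ u<1+m)
        ... | inj₂ (inj₁ refl) | inj₂ (inj₁ refl) = refl
        ... | inj₁ (u<m , u≡) | inj₁ (v<m , v≡) = injective u<m (trans (sym u≡) (trans eq v≡))
        ... | inj₁ (u<m , u≡) | inj₂ (inj₁ refl) =
          contradiction (trans (sym u≡) (trans eq visit-new)) (<⇒≢ u<m)
        ... | inj₂ (inj₁ refl) | inj₁ (v<m , v≡) =
          contradiction (trans (sym v≡) (trans (sym eq) visit-new)) (<⇒≢ v<m)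

        simplicial′ : ∀ u x {w} → visit c x < suc m → visit c u < visit c x → Reach (visit c) x w → u ~ w → u ~ x
        simplicial′ u x x<1+m u<x p u~w with visit-cases x
        ... | inj₂ (inj₂ (_ , _ , x≡)) = contradiction x≡ (<⇒≢ x<1+m)
        ... | inj₁ (x<m , x≡) =
          simplicial x<m (≤-<-trans (pos≤visit u) (subst (visit c u <_) x≡ u<x)) (visit⇒pos-reach x≡ p) u~w
        ... | inj₂ (inj₁ refl) =
          dominating chordal unv most (visit⇒pos-reach (trans visit-new (sym unv)) p)
            (≤-<-trans (pos≤visit u) (subst (visit c u <_) visit-new u<x)) u~w

  label≤n : ∀ {m pos} (st : Stage m pos) v → label st v ≤ length (allFin n)
  label≤n st v = length-filter (visitedNeighbour? st v) (allFin n)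

  elimination : Chordal G → ¬ ¬ ∃ IsElimination
  elimination chordal = go (allFin n) (<-wellFounded _) start λ v _ → ∈-allFin v
    where
    start : Stage 0 (λ _ → 0)
    start = record { bounded = λ _ → z≤n ; injective = λ () ; simplicial = λ () }

    -- The list `us` covers the unvisited vertices and loses `c` at each visit; its length bounds
    -- the recursion.
    go : ∀ (us : List V) → Acc _<_ (length us) → ∀ {m pos} (st : Stage m pos) →
         (∀ v → Unvisited st v → v ∈ us) → ¬ ¬ ∃ IsElimination
    go us (acc rec) {m} {pos} st covers = do
      yes unvisited ← em {A = ∃ (Unvisited st)}
        where no ∄ → let visited = λ v → ≤∧≢⇒< (bounded v) λ eq → ∄ (v , eq) in
                return (pos , record { injective = injective (visited _) ; simplicial = simplicial (visited _) })
      (c , unv , most) ← maximal (label st) _ (label≤n st) unvisited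
      go (filter (λ v → ¬? (v Fin.≟ c)) us)
         (rec (filter-notAll _ us (Any.map (λ c≡v v≢c → v≢c (sym c≡v)) (covers c unv))))
         (visit-stage st unv chordal most)
         λ v v≡1+m → remaining unv v (visit-cases st unv v) v≡1+m
      where
      open Stage st
      remaining : ∀ {c} (unv : Unvisited st c) v →
        (pos v < m × visit st c v ≡ pos v) ⊎ v ≡ c ⊎ (Unvisited st v × v ≢ c × visit st c v ≡ suc m) →
        visit st c v ≡ suc m → v ∈ filter (λ v → ¬? (v Fin.≟ c)) us
      remaining unv v (inj₁ (v<m , eq)) v≡1+m =
        contradiction (trans (sym eq) v≡1+m) (<⇒≢ (m<n⇒m<1+n v<m))
      remaining unv v (inj₂ (inj₁ refl)) v≡1+m =
        contradiction (trans (sym (visit-new st unv)) v≡1+m) (<⇒≢ ≤-refl)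
      remaining unv v (inj₂ (inj₂ (v≡m , v≢c , _))) _ = ∈-filter⁺ _ (covers v v≡m) v≢c

-- Walks, paths and distances

-- The function `f` is there for the induction, which passes to `f ∘ suc`; the list `upTo n`
-- searched by `dist` is the case `f = id`.
head-filter : {P : Pred ℕ 0ℓ} (P? : U.Decidable P) (f : ℕ → ℕ) (m : ℕ) →
  (∃ λ j → List.head (filter P? (List.applyUpTo f m)) ≡ just (f j) × j < m × P (f j) × (∀ {i} → i < j → ¬ P (f i)))
  ⊎ (List.head (filter P? (List.applyUpTo f m)) ≡ nothing × (∀ {i} → i < m → ¬ P (f i)))
head-filter P? f zero = inj₂ (refl , λ ())
head-filter P? f (suc m) with P? (f 0)
... | yes p = inj₁ (0 , refl , s≤s z≤n , p , λ ())
... | no ¬p with head-filter P? (f ∘ suc) m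
...   | inj₁ (j , eq , j<m , p , least) =
        inj₁ (suc j , eq , s≤s j<m , p , λ { {zero} _ → ¬p ; {suc i} (s≤s i<j) → least i<j })
...   | inj₂ (eq , none) = inj₂ (eq , λ { {zero} _ → ¬p ; {suc i} (s≤s i<m) → none i<m })

module Distance (G : Graph n) where
  open Graph G
  open Cycles G using (V)

  infixr 5 _∷_
  data Walk : V → V → ℕ → Set where
    []  : ∀ {u} → Walk u u 0
    _∷_ : ∀ {u v w ℓ} → u ~ v → Walk v w ℓ → Walk u w (suc ℓ)

  _++_ : ∀ {u v w k ℓ} → Walk u v k → Walk v w ℓ → Walk u w (k + ℓ)
  []      ++ q = q
  (e ∷ p) ++ q = e ∷ (p ++ q)

  reverse : ∀ {u v ℓ} → Walk u v ℓ → Walk v u ℓ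
  reverse []                = []
  reverse {ℓ = suc ℓ} (e ∷ p) = subst (Walk _ _) (+-comm ℓ 1) (reverse p ++ (~-sym e ∷ []))

  path⇒walk : ∀ {u v ℓ} → Path G u v ℓ → Walk u v ℓ
  path⇒walk (_ , refl , refl , linked , _) = go linked
    where
    go : ∀ {ℓ} {p : Vec V (suc ℓ)} → Linked _~_ p → Walk (Vec.head p) (Vec.last p) ℓ
    go {p = _ ∷ []}    [-]     = []
    go {p = _ ∷ _ ∷ _} (e ∷ l) = e ∷ go l

  suffix : ∀ {u ℓ} {p : Vec V (suc ℓ)} → VecAny.Any (u ≡_) p → Linked _~_ p → Unique p →
           ∃ λ k → k ≤ ℓ × Path G u (Vec.last p) k
  suffix {p = _ ∷ _}     (here refl) l       uniq     = _ , ≤-refl , _ , refl , refl , l , uniq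
  suffix {p = _ ∷ _ ∷ _} (there u∈)  (_ ∷ l) (_ ∷ uniq) =
    let k , k≤ , path = suffix u∈ l uniq in k , m≤n⇒m≤1+n k≤ , path

  -- If the new first vertex occurs on the path already, the path is cut down to its suffix from
  -- that occurrence.
  walk⇒path : ∀ {u v ℓ} → Walk u v ℓ → ∃ λ k → k ≤ ℓ × Path G u v k
  walk⇒path []      = 0 , z≤n , _ ∷ [] , refl , refl , [-] , VecAll.[] ∷ []
  walk⇒path {u} (e ∷ p) with walk⇒path p
  ... | k , k≤ℓ , p′@(_ ∷ _) , refl , refl , l , uniq with VecAll.decide (λ y → neq? y) p′
    where
    neq? : ∀ y → u ≢ y ⊎ u ≡ y
    neq? y with u Fin.≟ y
    ... | yes u≡y = inj₂ u≡y
    ... | no u≢y  = inj₁ u≢y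
  ...   | inj₁ fresh = suc k , s≤s k≤ℓ , u ∷ p′ , refl , refl , e ∷ l , fresh ∷ uniq
  ...   | inj₂ u∈p′  = let j , j≤k , path = suffix u∈p′ l uniq in j , m≤n⇒m≤1+n (≤-trans j≤k k≤ℓ) , path

  path-< : ∀ {u v ℓ} → Path G u v ℓ → ℓ < n
  path-< (p , _ , _ , _ , uniq) =
    Fin.injective⇒≤ {f = Vec.lookup p} (lookup-injective uniq _ _)

  dist-spec : ∀ u v →
    (∃ λ d → dist G u v ≡ [ d ] × Walk u v d × d < n × (∀ {ℓ} → Walk u v ℓ → d ≤ ℓ))
    ⊎ (dist G u v ≡ ∞ × (∀ {ℓ} → ¬ Walk u v ℓ))
  dist-spec u v with head-filter (path? G u v) id n
  ... | inj₁ (d , eq , d<n , path , least) = inj₁ (d , eq , path⇒walk path , d<n , shortest)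
    where
    shortest : ∀ {ℓ} → Walk u v ℓ → d ≤ ℓ
    shortest p = let k , k≤ℓ , path′ = walk⇒path p in
      ≤-trans (≮⇒≥ λ k<d → least k<d path′) k≤ℓ
  ... | inj₂ (eq , none) = inj₂ (eq , λ p → let _ , _ , path = walk⇒path p in none (path-< path) path)

  Connected : V → V → Set
  Connected u v = ∃ (Walk u v)

  connected-refl : ∀ {u} → Connected u u
  connected-refl = _ , []

  connected-sym : ∀ {u v} → Connected u v → Connected v u
  connected-sym (_ , p) = _ , reverse p

  connected-trans : ∀ {u v w} → Connected u v → Connected v w → Connected u w
  connected-trans (_ , p) (_ , q) = _ , p ++ q

  ~⇒connected : ∀ {u v} → u ~ v → Connected u v
  ~⇒connected e = _ , e ∷ []

  connected? : ∀ u v → Dec (Connected u v)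
  connected? u v with dist-spec u v
  ... | inj₁ (d , _ , p , _) = yes (d , p)
  ... | inj₂ (_ , none)      = no (none ∘ proj₂)

  opaque

    -- The value n at infinite distance exceeds all finite distances, so that
    -- the triangle inequality holds without connectivity assumptions.
    δ : V → V → ℕ
    δ u v = fromMaybe n (dist G u v)

    δ-shortest : ∀ {u v ℓ} → Walk u v ℓ → δ u v ≤ ℓ
    δ-shortest {u} {v} p with dist G u v | dist-spec u v
    ... | _ | inj₁ (d , refl , _ , _ , shortest) = shortest p
    ... | _ | inj₂ (_ , none)                    = contradiction p none

    geodesic : ∀ {u v} → Connected u v → Walk u v (δ u v)
    geodesic {u} {v} (_ , p) with dist G u v | dist-spec u v
    ... | _ | inj₁ (d , refl , q , _) = q
    ... | _ | inj₂ (_ , none)         = contradiction p none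

    δ≤n : ∀ u v → δ u v ≤ n
    δ≤n u v with dist G u v | dist-spec u v
    ... | _ | inj₁ (d , refl , _ , d<n , _) = <⇒≤ d<n
    ... | _ | inj₂ (refl , _)               = ≤-refl

    disconnected⇒δ≡n : ∀ {u v} → ¬ Connected u v → δ u v ≡ n
    disconnected⇒δ≡n {u} {v} ¬c with dist G u v | dist-spec u v
    ... | _ | inj₁ (d , refl , p , _) = contradiction (d , p) ¬c
    ... | _ | inj₂ (refl , _)         = refl

    δ-positive : ∀ {u v} → u ≢ v → 1 ≤ δ u v
    δ-positive {u} {v} u≢v with dist G u v | dist-spec u v
    ... | _ | inj₁ (zero , refl , [] , _) = contradiction refl u≢v
    ... | _ | inj₁ (suc _ , refl , _)     = s≤s z≤n
    ... | _ | inj₂ (refl , _)             = ≤-trans (s≤s z≤n) (Fin.toℕ<n u)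

    cap-far : ∀ {r u v} → r < δ u v → Cap r (dist G u v) ≡ ∞
    cap-far {r} {u} {v} r<δ with dist G u v
    ... | ∞     = refl
    ... | [ d ] rewrite dec-false (d ≤? r) (<⇒≱ r<δ) = refl

    cap-cong : ∀ {r u v w} → Connected u v → Connected u w → δ u v ≡ δ u w →
               Cap r (dist G u v) ≡ Cap r (dist G u w)
    cap-cong {r} {u} {v} {w} (_ , p) (_ , q) eq with dist G u v | dist-spec u v | dist G u w | dist-spec u w
    ... | _ | inj₁ (_ , refl , _) | _ | inj₁ (_ , refl , _) = cong (Cap r ∘ [_]) eq
    ... | _ | inj₂ (_ , none)     | _ | _                   = contradiction p none
    ... | _ | _                   | _ | inj₂ (_ , none)     = contradiction q none

  δ-refl : ∀ u → δ u u ≡ 0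
  δ-refl u = n≤0⇒n≡0 (δ-shortest [])

  δ-sym-≤ : ∀ u v → δ u v ≤ δ v u
  δ-sym-≤ u v with connected? v u
  ... | yes c = δ-shortest (reverse (geodesic c))
  ... | no ¬c = ≤-trans (δ≤n u v) (≤-reflexive (sym (disconnected⇒δ≡n ¬c)))

  δ-sym : ∀ u v → δ u v ≡ δ v u
  δ-sym u v = ≤-antisym (δ-sym-≤ u v) (δ-sym-≤ v u)

  δ-triangle : ∀ u v w → δ u w ≤ δ u v + δ v w
  δ-triangle u v w with connected? u v | connected? v w
  ... | yes c | yes c′ = δ-shortest (geodesic c ++ geodesic c′)
  ... | no ¬c | _ rewrite disconnected⇒δ≡n ¬c = ≤-trans (δ≤n u w) (m≤m+n n _)
  ... | yes _ | no ¬c rewrite disconnected⇒δ≡n ¬c = ≤-trans (δ≤n u w) (m≤n+m n _)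

  δ-edge : ∀ {u v} → u ~ v → δ u v ≤ 1
  δ-edge e = δ-shortest (e ∷ [])

  -- `p` and `q` are the ends of the first edge by which a geodesic leaves `P`.
  δ-cross : (P : V → Set) → ∀ {x y} → Connected x y → P x → ¬ P y →
            ¬ ¬ ∃₂ λ p q → P p × ¬ P q × p ~ q × δ x p + suc (δ q y) ≤ δ x y
  δ-cross P {x} {y} c px ¬py = do
    p , q , _ , _ , pp , ¬pq , e , w , w′ , eq ← go (geodesic c) px
    return (p , q , pp , ¬pq , e ,
      ≤-trans (+-mono-≤ (δ-shortest w) (s≤s (δ-shortest w′))) (≤-reflexive eq))
    where
    go : ∀ {x ℓ} → Walk x y ℓ → P x → ¬ ¬ ∃₂ λ p q → ∃₂ λ i j →
         P p × ¬ P q × p ~ q × Walk x p i × Walk q y j × i + suc j ≡ ℓ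
    go []      px = contradiction px ¬py
    go (_∷_ {v = v} e w) px = do
      yes pv ← em {A = P v}
        where no ¬pv → return (_ , _ , 0 , _ , px , ¬pv , e , [] , w , refl)
      p , q , i , j , pp , ¬pq , e′ , w₁ , w₂ , eq ← go w pv
      return (p , q , suc i , j , pp , ¬pq , e′ , e ∷ w₁ , w₂ , cong suc eq)

  cap-disconnected : ∀ {r u v} → ¬ Connected u v → Cap r (dist G u v) ≡ ∞
  cap-disconnected {r} {u} {v} ¬c with dist-spec u v
  ... | inj₁ (d , _ , p , _) = contradiction (d , p) ¬c
  ... | inj₂ (eq , _)        = cong (Cap r) eq

-- Clique separators in the elimination forest

module CliqueForest (G : Graph n) {pos : Fin n → ℕ} (elim : Elimination.IsElimination G pos) where
  open Graph G
  open Cycles G using (V)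
  open Reachability G pos
  open Elimination.IsElimination elim
  open Distance G hiding ([]; _∷_)

  reach⇒connected : ∀ {u v} → Reach u v → Connected u v
  reach⇒connected here         = connected-refl
  reach⇒connected (step p e _) = connected-trans (reach⇒connected p) (~⇒connected e)

  reach-antisym : ∀ {u v} → Reach u v → Reach v u → u ≡ v
  reach-antisym p q = injective (≤-antisym (reach⇒≤ p) (reach⇒≤ q))

  reach-chain : ∀ {u v w} → Reach u w → Reach v w → Reach u v ⊎ Reach v u
  reach-chain {u} {v} p q with ≤-total (pos u) (pos v)
  ... | inj₁ u≤v = inj₁ (reach-join p q u≤v)
  ... | inj₂ v≤u = inj₂ (reach-join q p v≤u)

  ~⇒comparable : ∀ {u v} → u ~ v → Reach u v ⊎ Reach v u
  ~⇒comparable {u} {v} e with ≤-total (pos u) (pos v)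
  ... | inj₁ u≤v = inj₁ (edge u≤v e)
  ... | inj₂ v≤u = inj₂ (edge v≤u (~-sym e))

  Bag : V → V → Set
  Bag w u = Reach u w × (u ≡ w ⊎ u ~ w)

  bag-self : ∀ {w} → Bag w w
  bag-self = here , inj₁ refl

  bag-clique : ∀ {w u v} → Bag w u → Bag w v → δ u v ≤ 1
  bag-clique {u = u} (_ , inj₁ refl) (_ , inj₁ refl) = ≤-trans (≤-reflexive (δ-refl u)) z≤n
  bag-clique (_ , inj₁ refl) (_ , inj₂ v~w) = δ-edge (~-sym v~w)
  bag-clique (_ , inj₂ u~w) (_ , inj₁ refl) = δ-edge u~w
  bag-clique {u = u} {v} (p , inj₂ u~w) (q , inj₂ v~w) with <-cmp (pos u) (pos v)
  ... | tri< u<v _ _ = δ-edge (simplicial u<v q u~w)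
  ... | tri> _ _ v<u = δ-edge (~-sym (simplicial v<u p v~w))
  ... | tri≈ _ u≡v _ with refl ← injective u≡v = ≤-trans (≤-reflexive (δ-refl u)) z≤n

  -- The running intersection property: by `simplicial`, a vertex `u` stays in the bags on the way
  -- from `w` up to `u`.
  bag-up : ∀ {u x w} → Bag w u → Reach u x → Reach x w → Bag x u
  bag-up (_ , inj₁ refl) p q = p , inj₁ (reach-antisym p q)
  bag-up {u} {x} (_ , inj₂ u~w) p q with m≤n⇒m<n∨m≡n (reach⇒≤ p)
  ... | inj₁ u<x = p , inj₂ (simplicial u<x q u~w)
  ... | inj₂ u≡x = p , inj₁ (injective u≡x)

  -- For connected `x` and `y`: some geodesic between them meets `K`.
  Separates : (V → Set) → V → V → Set
  Separates K x y = ∃ λ u → K u × δ x u + δ u y ≤ δ x y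

  through-edge : ∀ {p q} x y → p ~ q → δ x p + suc (δ q y) ≤ δ x y → δ x q + δ q y ≤ δ x y
  through-edge {p} {q} x y p~q bound = begin
    δ x q + δ q y         ≤⟨ +-monoˡ-≤ _ (δ-triangle x p q) ⟩
    δ x p + δ p q + δ q y ≤⟨ +-monoˡ-≤ _ (+-monoʳ-≤ (δ x p) (δ-edge p~q)) ⟩
    δ x p + 1 + δ q y     ≡⟨ +-assoc (δ x p) 1 _ ⟩
    δ x p + suc (δ q y)   ≤⟨ bound ⟩
    δ x y                 ∎
    where open ≤-Reasoning

  -- An edge leaving the subtree of `w` leads to an ancestor of its start that is not below `w`,
  -- hence to an ancestor of `w`; `bag-up` puts it into the bag of `w`.
  subtree-separates : ∀ {w x y} → Connected x y → Reach w x → ¬ Reach w y →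
                      ¬ ¬ Separates (λ u → Bag w u × ¬ Reach w u) x y
  subtree-separates {w} {x} {y} c w⊑x w⋢y = do
    p , q , w⊑p , w⋢q , p~q , bound ← δ-cross (Reach w) c w⊑x w⋢y
    let q⊑p = [ (λ p⊑q → contradiction (reach-trans w⊑p p⊑q) w⋢q) , id ]′ (~⇒comparable p~q)
        q⊑w = [ id , (λ w⊑q → contradiction w⊑q w⋢q) ]′ (reach-chain q⊑p w⊑p)
    return (q , (bag-up (q⊑p , inj₂ (~-sym p~q)) q⊑w w⊑p , w⋢q) , through-edge x y p~q bound)

  -- The vertices in the same component as v of the graph of all vertices
  -- strictly below w.
  Branch : V → V → V → Set
  Branch w v p = ∃ λ z → Reach z p × Reach z v × pos w < pos z

  -- An edge out of the branch leads to an ancestor of `z`, which cannot be strictly below `w` and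
  -- so is `w` or above it. That it lies in a bag strictly below `w` as well is used in
  -- `lower-reach-is-closer`.
  branch-separates : ∀ {w v x y} → Reach w v → Connected x y → Branch w v x → ¬ Branch w v y →
    ¬ ¬ Separates (λ u → Bag w u × ∃ λ z → Bag z u × Reach z v × pos w < pos z) x y
  branch-separates {w} {v} {x} {y} w⊑v c bx ¬by = do
    p , q , (z , z⊑p , z⊑v , w<z) , ¬bq , p~q , bound ← δ-cross (Branch w v) c bx ¬by
    let z⋢q = λ z⊑q → ¬bq (z , z⊑q , z⊑v , w<z)
        q⊑p = [ (λ p⊑q → contradiction (reach-trans z⊑p p⊑q) z⋢q) , id ]′ (~⇒comparable p~q)
        q⊑z = [ id , (λ z⊑q → contradiction z⊑q z⋢q) ]′ (reach-chain q⊑p z⊑p)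
        bag-z = bag-up (q⊑p , inj₂ (~-sym p~q)) q⊑z z⊑p
        w⊑z = reach-join w⊑v z⊑v (<⇒≤ w<z)
        q⊑w = reach-join q⊑z w⊑z (≮⇒≥ λ w<q → ¬bq (q , here , reach-trans q⊑z z⊑v , w<q))
    return (q , (bag-up bag-z q⊑w w⊑z , z , bag-z , z⊑v , w<z) , through-edge x y p~q bound)

  -- A geodesic from `a` to `u′` leaves the branch of `m` below `ℓ` at some `p` in the bag of `ℓ`.
  -- As `p` is also in a bag below `ℓ`, it differs from `u′`: it is at least one step from `u′` and
  -- at most one from `u`.
  lower-reach-is-closer : ∀ {m ℓ u u′ a} → Reach ℓ m → Bag ℓ u → ¬ Bag m u → Reach u′ m →
    (∀ y → Reach y m → Bag y u′ → pos y ≤ pos ℓ) → Reach m a → δ u a ≤ δ u′ a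
  lower-reach-is-closer {m} {ℓ} {u} {u′} {a} ℓ⊑m bag-u ¬bag-m u′⊑m highest m⊑a =
    decidable-stable (_ ≤? _) do
      p , (bag-p , z , bag-z , z⊑m , ℓ<z) , bound ←
        branch-separates ℓ⊑m (connected-sym (reach⇒connected (reach-trans u′⊑m m⊑a)))
          (m , m⊑a , here , ℓ<m) (λ (z , z⊑u′ , _ , ℓ<z) →
            <⇒≱ ℓ<z (≤-trans (reach⇒≤ z⊑u′) (highest u′ u′⊑m bag-self)))
      let p≢u′ = λ { refl → <⇒≱ ℓ<z (highest z z⊑m bag-z) }
      return (begin
        δ u a            ≤⟨ δ-triangle u p a ⟩
        δ u p + δ p a    ≤⟨ +-mono-≤ (bag-clique bag-u bag-p) (≤-reflexive (δ-sym p a)) ⟩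
        1 + δ a p        ≤⟨ +-monoˡ-≤ (δ a p) (δ-positive p≢u′) ⟩
        δ p u′ + δ a p   ≡⟨ +-comm (δ p u′) _ ⟩
        δ a p + δ p u′   ≤⟨ bound ⟩
        δ a u′           ≡⟨ δ-sym a u′ ⟩
        δ u′ a           ∎)
    where
    open ≤-Reasoning
    ℓ<m : pos ℓ < pos m
    ℓ<m = ≤∧≢⇒< (reach⇒≤ ℓ⊑m) λ eq → ¬bag-m (subst (λ x → Bag x u) (injective eq) bag-u)

  -- A geodesic from `u′` to `b` leaves the subtree of `u` for a neighbour `p` of `u`, which differs
  -- from `u′` because `u′` is in the subtree.
  ancestor-is-closer : ∀ {u u′ b} → Reach u u′ → ¬ Reach u b → Connected u′ b → δ u b ≤ δ u′ b
  ancestor-is-closer {u} {u′} {b} u⊑u′ u⋢b c = decidable-stable (_ ≤? _) do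
    p , (bag-p , u⋢p) , bound ← subtree-separates c u⊑u′ u⋢b
    let u′≢p = λ { refl → u⋢p u⊑u′ }
    return (begin
      δ u b           ≤⟨ δ-triangle u p b ⟩
      δ u p + δ p b   ≤⟨ +-monoˡ-≤ _ (bag-clique bag-self bag-p) ⟩
      1 + δ p b       ≤⟨ +-monoˡ-≤ _ (δ-positive u′≢p) ⟩
      δ u′ p + δ p b  ≤⟨ bound ⟩
      δ u′ b          ∎)
    where open ≤-Reasoning

  -- The vertices are nearest once `d` bounds `δ v` on the bag from below, which is stated
  -- separately where it is used.
  Nearest : V → V → ℕ → V → Set
  Nearest w v d u = Bag w u × δ v u ≡ d

  nearest-≤-1 : ∀ {w v d u u′} a → Nearest w v d u → Bag w u′ → δ u a ≤ 1 + δ u′ a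
  nearest-≤-1 {u = u} {u′} a (bag-u , _) bag-u′ =
    ≤-trans (δ-triangle u u′ a) (+-monoˡ-≤ _ (bag-clique bag-u bag-u′))

  -- A geodesic from `v′` crosses its bag at some `u′`. If `u′` is not nearest, reaching it costs at
  -- least one more than `d`, which pays for a step inside the clique from a nearest vertex to `u′`.
  δ-mono-nearest : ∀ {v v′ w w′ d u a} → (∀ s → Bag w′ s → d ≤ δ v′ s) → ∃ (Nearest w′ v′ d) →
    Nearest w v d u → (∀ u′ → Nearest w′ v′ d u′ → δ u a ≤ δ u′ a) → Separates (Bag w′) v′ a →
    δ v a ≤ δ v′ a
  δ-mono-nearest {v} {v′} {w} {w′} {d} {u} {a} d≤ (s , near-s) (_ , δvu≡d) closer (u′ , bag-u′ , bound) =
    begin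
      δ v a            ≤⟨ δ-triangle v u a ⟩
      δ v u + δ u a    ≡⟨ cong (_+ δ u a) δvu≡d ⟩
      d + δ u a        ≤⟨ through-u′ ⟩
      δ v′ u′ + δ u′ a ≤⟨ bound ⟩
      δ v′ a           ∎
    where
    open ≤-Reasoning
    through-u′ : d + δ u a ≤ δ v′ u′ + δ u′ a
    through-u′ with m≤n⇒m<n∨m≡n (d≤ u′ bag-u′)
    ... | inj₂ d≡ = +-mono-≤ (≤-reflexive d≡) (closer u′ (bag-u′ , sym d≡))
    ... | inj₁ d< = begin
      d + δ u a          ≤⟨ +-monoʳ-≤ d (≤-trans (closer s near-s) (nearest-≤-1 a near-s bag-u′)) ⟩
      d + (1 + δ u′ a)   ≡⟨ +-suc d _ ⟩
      suc d + δ u′ a     ≤⟨ +-monoˡ-≤ _ d< ⟩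
      δ v′ u′ + δ u′ a   ∎

  -- A relation, since the minimum is only obtained under double negation.
  SetDistance : (V → Set) → (V → Set) → ℕ → Set
  SetDistance S K x = (∃₂ λ u q → S u × K q × δ u q ≡ x) × (∀ u q → S u → K q → x ≤ δ u q)

  setDistance : ∀ {S K} → ∃ S → ∃ K → ¬ ¬ ∃ (SetDistance S K)
  setDistance {S} {K} (u , s) (q , k) = do
    (u , q) , (s , k) , least ← minimal (λ (u , q) → δ u q) {P = λ (u , q) → S u × K q} ((u , q) , s , k)
    return (δ u q , (u , q , s , k , refl) , λ u q s k → least (u , q) (s , k))

  -- A geodesic to `a` crosses the bag of `w` and then `K`. Crossing the bag at a vertex that is not
  -- nearest saves at most one on the way to `K` and costs at least one before.
  level-≥ : ∀ {v w d K x e a} → (∀ s → Bag w s → d ≤ δ v s) → ∃ (Nearest w v d) →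
    SetDistance (Nearest w v d) K x → SetDistance K (_≡ a) e → Separates (Bag w) v a →
    (∀ u → Bag w u → ¬ ¬ Separates K u a) → d + x + e ≤ δ v a
  level-≥ {v} {w} {d} {K} {x} {e} {a} d≤ (s , near-s) (_ , x≤) (_ , e≤) (u , bag-u , bound) sepK =
    decidable-stable (_ ≤? _) do
      q , kq , bound′ ← sepK u bag-u
      return (begin
        d + x + e                  ≡⟨ +-assoc d x e ⟩
        d + (x + e)                ≤⟨ through-u kq bound′ ⟩
        δ v u + δ u a              ≤⟨ bound ⟩
        δ v a                      ∎)
    where
    open ≤-Reasoning
    through-u : ∀ {q} → K q → δ u q + δ q a ≤ δ u a → d + (x + e) ≤ δ v u + δ u a
    through-u {q} kq bound′ with m≤n⇒m<n∨m≡n (d≤ u bag-u)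
    ... | inj₂ d≡ = +-mono-≤ (≤-reflexive d≡)
          (≤-trans (+-mono-≤ (x≤ u q (bag-u , sym d≡) kq) (e≤ q a kq refl)) bound′)
    ... | inj₁ d< = begin
      d + (x + e)                 ≤⟨ +-monoʳ-≤ d (+-mono-≤ (≤-trans (x≤ s q near-s kq) (nearest-≤-1 q near-s bag-u)) (e≤ q a kq refl)) ⟩
      d + (suc (δ u q) + δ q a)   ≡⟨ +-suc d _ ⟩
      suc d + (δ u q + δ q a)     ≤⟨ +-mono-≤ d< bound′ ⟩
      δ v u + δ u a               ∎

  -- The pairs realising `x` and `e` may end at different vertices of `K`; the additional 1 is the
  -- edge between them.
  level-≤ : ∀ {v w d K x e a} → (∀ p q → K p → K q → δ p q ≤ 1) →
    SetDistance (Nearest w v d) K x → SetDistance K (_≡ a) e → δ v a ≤ suc (d + x + e)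
  level-≤ {v} {w} {d} {K} {x} {e} {a} clique
    ((u , q , (_ , δvu≡d) , kq , δuq≡x) , _) ((p , _ , kp , refl , δpa≡e) , _) = begin
      δ v a                                 ≤⟨ δ-triangle v u a ⟩
      δ v u + δ u a                         ≤⟨ +-monoʳ-≤ (δ v u) (δ-triangle u q a) ⟩
      δ v u + (δ u q + δ q a)               ≤⟨ +-monoʳ-≤ (δ v u) (+-monoʳ-≤ (δ u q) (δ-triangle q p a)) ⟩
      δ v u + (δ u q + (δ q p + δ p a))     ≤⟨ +-monoʳ-≤ (δ v u) (+-monoʳ-≤ (δ u q) (+-monoˡ-≤ (δ p a) (clique q p kq kp))) ⟩
      δ v u + (δ u q + (1 + δ p a))         ≡⟨ cong₂ (λ α β → α + (β + (1 + δ p a))) δvu≡d δuq≡x ⟩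
      d + (x + (1 + δ p a))                 ≡⟨ cong (λ γ → d + (x + (1 + γ))) δpa≡e ⟩
      d + (x + (1 + e))                     ≡⟨ rearrange d x e ⟩
      suc (d + x + e)                       ∎
    where
    open ≤-Reasoning
    rearrange : ∀ d x e → d + (x + (1 + e)) ≡ suc (d + x + e)
    rearrange = solve-∀

-- Classes of vertices above the given elements

bounded : (f : Fin n → ℕ) → ∃ λ b → ∀ i → f i ≤ b
bounded {zero}  f = 0 , λ ()
bounded {suc n} f = let b , f≤b = bounded (f ∘ suc) in
  f zero ⊔ b , λ { zero → m≤m⊔n _ b ; (suc i) → ≤-trans (f≤b i) (m≤n⊔m (f zero) b) }

module Classes (G : Graph n) {pos : Fin n → ℕ} (elim : Elimination.IsElimination G pos) where
  open Graph G
  open Cycles G using (V)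
  open Reachability G pos
  open Elimination.IsElimination elim
  open Distance G hiding ([]; _∷_)
  open CliqueForest G elim

  lowest : {P : A → Set} (f : A → V) → ∃ P → ¬ ¬ ∃ (IsMaximal (pos ∘ f) P)
  lowest f = maximal (pos ∘ f) _ λ a → proj₂ (bounded pos) (f a)

  -- The vertices above some α i fall into classes according to the set of all
  -- α j below them.  The lowest members of the classes are among the α i and
  -- the lowest common ancestors of α i with the later ones.
  bottoms : ∀ {k} (α : Fin k → V) → ¬ ¬ ∃ λ (J : Fin k → V) → ∀ w i → Reach w (α i) →
            ¬ ¬ ∃ λ c → Reach w ([ α , J ]′ c) × (∀ j → Reach w (α j) → Reach ([ α , J ]′ c) (α j))
  bottoms {zero}  α = return ((λ ()) , λ w ())
  bottoms {suc k} α = do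
    J , below ← bottoms (α ∘ suc)
    a , a-lca ← lca
    return (insert a J , λ w i w⊑i → do
      yes (i′ , w⊑i′) ← em {A = ∃ λ i → Reach w (α (suc i))}
        where no ∄ → return (inj₁ zero , alone ∄ i w⊑i)
      c , w⊑c , all ← below w i′ w⊑i′
      yes w⊑0 ← em {A = Reach w (α zero)}
        where no w⋢0 → return (old a J c w⊑c λ { zero w⊑0 → contradiction w⊑0 w⋢0 ; (suc j) → all j })
      no c⋢0 ← em {A = Reach ([ α ∘ suc , J ]′ c) (α zero)}
        where yes c⊑0 → return (old a J c w⊑c λ { zero _ → c⊑0 ; (suc j) → all j })
      -- Here `w` is above `α zero` but `c` is not. The lowest common ancestor `a` lies below `w`
      -- and above `c`, hence above every `α j` that `w` is above.
      let a⊑0 , (b , a⊑b) , w≤a = a-lca w i′ w⊑0 w⊑i′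
          w⊑a = reach-join w⊑0 a⊑0 w≤a
          a⊑c = [ id , (λ c⊑a → contradiction (reach-trans c⊑a a⊑0) c⋢0) ]′
                  (reach-chain a⊑b (all b (reach-trans w⊑a a⊑b)))
      return (inj₂ zero , w⊑a , λ { zero _ → a⊑0 ; (suc j) w⊑j → reach-trans a⊑c (all j w⊑j) }))
    where
    insert : V → (Fin k → V) → Fin (suc k) → V
    insert a J zero    = a
    insert a J (suc i) = J i

    lca : ¬ ¬ ∃ λ a → ∀ w i → Reach w (α zero) → Reach w (α (suc i)) →
          Reach a (α zero) × (∃ λ b → Reach a (α (suc b))) × pos w ≤ pos a
    lca = do
      yes common ← em {A = ∃ λ x → Reach x (α zero) × ∃ λ i → Reach x (α (suc i))}
        -- With no common ancestor at all, `α zero` is an arbitrary value.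
        where no ∄ → return (α zero , λ w i w⊑0 w⊑i → contradiction (w , w⊑0 , i , w⊑i) ∄)
      a , (a⊑0 , a⊑b) , a-lowest ← lowest id common
      return (a , λ w i w⊑0 w⊑i → a⊑0 , a⊑b , a-lowest w (w⊑0 , i , w⊑i))

    alone : ∀ {w} → ¬ (∃ λ i → Reach w (α (suc i))) → ∀ i → Reach w (α i) →
            Reach w (α zero) × (∀ j → Reach w (α j) → Reach (α zero) (α j))
    alone ∄ zero    w⊑0 = w⊑0 , λ { zero _ → here ; (suc j) w⊑j → contradiction (j , w⊑j) ∄ }
    alone ∄ (suc i) w⊑i = contradiction (i , w⊑i) ∄

    old : ∀ {w} a J c → Reach w ([ α ∘ suc , J ]′ c) →
      (∀ j → Reach w (α j) → Reach ([ α ∘ suc , J ]′ c) (α j)) →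
      ∃ λ c → Reach w ([ α , insert a J ]′ c) × (∀ j → Reach w (α j) → Reach ([ α , insert a J ]′ c) (α j))
    old a J (inj₁ c) w⊑c all = inj₁ (suc c) , w⊑c , all
    old a J (inj₂ c) w⊑c all = inj₂ (suc c) , w⊑c , all

  module _ {k : ℕ} (α : Fin k → V) where

    -- As `w` is above `m`, the inclusion makes `w` and `m` lie above the same `α i`.
    SameClass : V → V → Set
    SameClass w m = Reach w m × (∀ i → Reach w (α i) → Reach m (α i))

    -- The choices for a class that do not depend on the vertex `v`, so that codes of different
    -- vertices refer to the same constants.
    record Frame (m : V) : Set where
      field
        top       : V
        top-class : SameClass top m
        top-least : ∀ t → SameClass t m → pos top ≤ pos t
        below?    : ∀ i → Dec (Reach m (α i))
        bottom-distance : ∀ i → ∃ (SetDistance (Bag m) (_≡ α i))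
        top-distance    : ∀ i → ∃ (SetDistance (Bag top) (_≡ α i))

    frame : ∀ m → ¬ ¬ Frame m
    frame m = do
      t , class , least ← minimal pos {P = λ t → SameClass t m} (m , here , λ _ → id)
      below? ← ¬¬-choice λ i → em {A = Reach m (α i)}
      e ← ¬¬-choice λ i → setDistance {S = Bag m} {K = _≡ α i} (m , bag-self) (α i , refl)
      f ← ¬¬-choice λ i → setDistance {S = Bag t} {K = _≡ α i} (t , bag-self) (α i , refl)
      return record
        { top = t ; top-class = class ; top-least = least
        ; below? = below? ; bottom-distance = e ; top-distance = f }

    module _ {m : V} (F : Frame m) where
      open Frame F renaming (top to t)

      record Located (v : V) (d x y : ℕ) : Set where
        field
          {w}         : V
          w⊑v         : Reach w v
          class       : SameClass w m
          w-lowest    : ∀ z i → Reach z v → Reach z (α i) → pos z ≤ pos w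
          d≤          : ∀ u → Bag w u → d ≤ δ v u
          nearest     : ∃ (Nearest w v d)
          bottom-dist : SetDistance (Nearest w v d) (Bag m) x
          top-dist    : SetDistance (Nearest w v d) (Bag t) y

        w⊑m : Reach w m
        w⊑m = proj₁ class

        t⊑w : Reach t w
        t⊑w = reach-join (proj₁ top-class) w⊑m (top-least w class)

        connected : Connected v m
        connected = connected-trans (connected-sym (reach⇒connected w⊑v)) (reach⇒connected w⊑m)

        -- By the choice of `w`, no ancestor of `v` strictly below `w` is above an `α i`, so the
        -- branch of `v` contains none of them.
        bag-separates : ∀ i → Connected v (α i) → ¬ ¬ Separates (Bag w) v (α i)
        bag-separates i c with v Fin.≟ w
        ... | yes v≡w = return (v , subst (λ z → Bag z v) v≡w bag-self , ≤-reflexive (cong (_+ δ v (α i)) (δ-refl v)))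
        ... | no v≢w = do
          u , (bag-u , _) , bound ← branch-separates w⊑v c
            (v , here , here , ≤∧≢⇒< (reach⇒≤ w⊑v) λ eq → v≢w (injective (sym eq)))
            λ (z , z⊑i , z⊑v , w<z) → <⇒≱ w<z (w-lowest z i z⊑v z⊑i)
          return (u , bag-u , bound)

        bottom-separates : ∀ {i} → Reach m (α i) → ∀ u → Bag w u → ¬ ¬ Separates (Bag m) u (α i)
        bottom-separates {i} m⊑i u (u⊑w , _) = do
          no m⋢u ← em {A = Reach m u}
            where yes m⊑u → return (u , subst (Bag m) (reach-antisym m⊑u (reach-trans u⊑w w⊑m)) bag-self ,
                                      ≤-reflexive (cong (_+ δ u (α i)) (δ-refl u)))
          p , (bag-p , _) , bound ← subtree-separates
            (connected-sym (reach⇒connected (reach-trans u⊑w (reach-trans w⊑m m⊑i)))) m⊑i m⋢u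
          return (p , bag-p , (begin
            δ u p + δ p (α i)   ≡⟨ +-comm (δ u p) _ ⟩
            δ p (α i) + δ u p   ≡⟨ cong₂ _+_ (δ-sym p (α i)) (δ-sym u p) ⟩
            δ (α i) p + δ p u   ≤⟨ bound ⟩
            δ (α i) u           ≡⟨ δ-sym (α i) u ⟩
            δ u (α i)           ∎))
          where open ≤-Reasoning

        -- A vertex `u` of the bag above `t` is in the bag of `t` itself. Otherwise `u` is in the
        -- subtree of `t`, while `α i` is not, because `t` is above the same elements as `m`.
        top-separates : ∀ {i} → ¬ Reach m (α i) → Connected m (α i) →
                        ∀ u → Bag w u → ¬ ¬ Separates (Bag t) u (α i)
        top-separates {i} m⋢i c u bag-u@(u⊑w , _) with reach-chain u⊑w t⊑w
        ... | inj₁ u⊑t = return (u , bag-up bag-u u⊑t t⊑w , ≤-reflexive (cong (_+ δ u (α i)) (δ-refl u)))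
        ... | inj₂ t⊑u = do
          p , (bag-p , _) , bound ← subtree-separates
            (connected-trans (reach⇒connected (reach-trans u⊑w w⊑m)) c) t⊑u (m⋢i ∘ proj₂ top-class i)
          return (p , bag-p , bound)

        distance-below : ∀ {i e} → Reach m (α i) → SetDistance (Bag m) (_≡ α i) e →
          d + x + e ≤ δ v (α i) × δ v (α i) ≤ suc (d + x + e)
        distance-below {i} m⊑i e-dist =
          decidable-stable (_ ≤? _) (do
            sep ← bag-separates i (connected-trans connected (reach⇒connected m⊑i))
            return (level-≥ d≤ nearest bottom-dist e-dist sep (bottom-separates m⊑i))) ,
          level-≤ (λ _ _ → bag-clique) bottom-dist e-dist

        distance-not-below : ∀ {i e} → ¬ Reach m (α i) → Connected m (α i) → SetDistance (Bag t) (_≡ α i) e →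
          d + y + e ≤ δ v (α i) × δ v (α i) ≤ suc (d + y + e)
        distance-not-below {i} m⋢i c e-dist =
          decidable-stable (_ ≤? _) (do
            sep ← bag-separates i (connected-trans connected c)
            return (level-≥ d≤ nearest top-dist e-dist sep (top-separates m⋢i c))) ,
          level-≤ (λ _ _ → bag-clique) top-dist e-dist

        -- A geodesic from m to t passes through the clique Bag w, so x and y
        -- essentially add up to its length.
        span-≤ : δ m t ≤ 3 + (x + y)
        span-≤ with bottom-dist | top-dist
        ... | (u , q , near-u , bag-q , refl) , _ | (u′ , q′ , near-u′ , bag-q′ , refl) , _ = begin
          δ m t                                                ≤⟨ δ-triangle m q t ⟩
          δ m q + δ q t                                        ≤⟨ +-mono-≤ (bag-clique bag-self bag-q) (δ-triangle q u t) ⟩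
          1 + (δ q u + δ u t)                                  ≤⟨ s≤s (+-mono-≤ (≤-reflexive (δ-sym q u)) (δ-triangle u u′ t)) ⟩
          1 + (δ u q + (δ u u′ + δ u′ t))                      ≤⟨ s≤s (+-monoʳ-≤ (δ u q) (+-mono-≤ (bag-clique (proj₁ near-u) (proj₁ near-u′)) (δ-triangle u′ q′ t))) ⟩
          1 + (δ u q + (1 + (δ u′ q′ + δ q′ t)))               ≤⟨ s≤s (+-monoʳ-≤ (δ u q) (s≤s (+-monoʳ-≤ (δ u′ q′) (bag-clique bag-q′ bag-self)))) ⟩
          1 + (δ u q + (1 + (δ u′ q′ + 1)))                    ≡⟨ rearrange (δ u q) (δ u′ q′) ⟩
          3 + (δ u q + δ u′ q′)                                ∎
          where
          open ≤-Reasoning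
          rearrange : ∀ a b → 1 + (a + (1 + (b + 1))) ≡ 3 + (a + b)
          rearrange = solve-∀

        span-≥ : x + y ≤ 2 + δ m t
        span-≥ = decidable-stable (_ ≤? _) do
          p , bag-p , bound ← separated
          let s , near-s = nearest
          return (begin
            x + y                         ≤⟨ +-mono-≤ (proj₂ bottom-dist s m near-s bag-self) (proj₂ top-dist s t near-s bag-self) ⟩
            δ s m + δ s t                 ≤⟨ +-mono-≤ (nearest-≤-1 m near-s bag-p) (nearest-≤-1 t near-s bag-p) ⟩
            1 + δ p m + (1 + δ p t)       ≡⟨ cong (λ a → 1 + a + (1 + δ p t)) (δ-sym p m) ⟩
            1 + δ m p + (1 + δ p t)       ≡⟨ rearrange (δ m p) (δ p t) ⟩
            2 + (δ m p + δ p t)           ≤⟨ s≤s (s≤s bound) ⟩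
            2 + δ m t                     ∎)
          where
          open ≤-Reasoning
          rearrange : ∀ a b → 1 + a + (1 + b) ≡ 2 + (a + b)
          rearrange = solve-∀

          separated : ¬ ¬ Separates (Bag w) m t
          separated with w Fin.≟ t
          ... | yes w≡t = return (t , subst (λ z → Bag z t) (sym w≡t) bag-self ,
              ≤-reflexive (trans (cong (δ m t +_) (δ-refl t)) (+-identityʳ _)))
          ... | no w≢t = do
            p , (bag-p , _) , bound ← subtree-separates (connected-sym (reach⇒connected (proj₁ top-class))) w⊑m
              λ w⊑t → w≢t (reach-antisym w⊑t t⊑w)
            return (p , bag-p , bound)

      module _ {v v′ d x x′ y y′} (L : Located v d x y) (L′ : Located v′ d x′ y′) where
        private
          module L = Located L
          module L′ = Located L′

        -- `ℓ` measures how far down towards `m` the bags with a nearest vertex reach; reaching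
        -- further down means being closer to everything below `m`. By `x ≢ 0`, `u` is not in the
        -- bag of `m`.
        below-≤ : ∀ {ℓ u ℓ′ u′} → x ≢ 0 →
          IsMaximal (pos ∘ proj₁) (λ (ℓ , u) → Reach ℓ m × Bag ℓ u × Nearest L.w v d u) (ℓ , u) →
          IsMaximal (pos ∘ proj₁) (λ (ℓ , u) → Reach ℓ m × Bag ℓ u × Nearest L′.w v′ d u) (ℓ′ , u′) →
          pos ℓ′ ≤ pos ℓ → ∀ i → Reach m (α i) → δ v (α i) ≤ δ v′ (α i)
        below-≤ {ℓ} {u} x≢0 ((ℓ⊑m , bag-u , near-u) , _) (_ , highest) ℓ′≤ℓ i m⊑i = decidable-stable (_ ≤? _) do
          sep ← L′.bag-separates i (connected-trans L′.connected (reach⇒connected m⊑i))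
          return (δ-mono-nearest L′.d≤ L′.nearest near-u
            (λ u′ near-u′ → lower-reach-is-closer ℓ⊑m bag-u
              (λ bag-m → x≢0 (n≤0⇒n≡0 (≤-trans (proj₂ L.bottom-dist u u near-u bag-m) (≤-reflexive (δ-refl u)))))
              (reach-trans (proj₁ (proj₁ near-u′)) L′.w⊑m)
              (λ z z⊑m bag-z → ≤-trans (highest (z , u′) (z⊑m , bag-z , near-u′)) ℓ′≤ℓ) m⊑i)
            sep)

        -- The topmost nearest vertex decides. By `y ≢ 0`, `u` is not in the bag of `t`, so it is
        -- below `t` and above no `α i` that `m` is not above; `ancestor-is-closer` then compares it
        -- with every nearest vertex of `v′`.
        not-below-≤ : ∀ {u u′} → y ≢ 0 → IsMinimal pos (Nearest L.w v d) u → IsMinimal pos (Nearest L′.w v′ d) u′ →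
          pos u ≤ pos u′ → ∀ i → ¬ Reach m (α i) → Connected m (α i) → δ v (α i) ≤ δ v′ (α i)
        not-below-≤ {u} y≢0 (near-u , _) (_ , least) u≤u′ i m⋢i c = decidable-stable (_ ≤? _) do
          sep ← L′.bag-separates i (connected-trans L′.connected c)
          return (δ-mono-nearest L′.d≤ L′.nearest near-u
            (λ s near-s → let s⊑m = reach-trans (proj₁ (proj₁ near-s)) L′.w⊑m in
              ancestor-is-closer
                (reach-join (reach-trans u⊑w L.w⊑m) s⊑m (≤-trans u≤u′ (least s near-s)))
                (λ u⊑i → m⋢i (proj₂ top-class i (reach-trans t⊑u u⊑i)))
                (connected-trans (reach⇒connected s⊑m) c))
            sep)
          where
          u⊑w : Reach u L.w
          u⊑w = proj₁ (proj₁ near-u)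
          t⊑u : Reach t u
          t⊑u = [ (λ u⊑t → contradiction
                    (n≤0⇒n≡0 (≤-trans (proj₂ L.top-dist u u near-u (bag-up (proj₁ near-u) u⊑t L.t⊑w)) (≤-reflexive (δ-refl u)))) y≢0)
                , id ]′ (reach-chain u⊑w L.t⊑w)

      Comparable : (Fin k → Set) → V → V → Set
      Comparable P v v′ = (∀ i → P i → δ v (α i) ≤ δ v′ (α i)) ⊎ (∀ i → P i → δ v′ (α i) ≤ δ v (α i))

      module _ {v v′ d x x′ y y′} (L : Located v d x y) (L′ : Located v′ d x′ y′) where

        below-comparable : x ≢ 0 → x′ ≢ 0 → ¬ ¬ Comparable (λ i → Reach m (α i)) v v′
        below-comparable x≢0 x′≢0 = do
          (ℓ , u) , peak ← lowest proj₁ (start L)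
          (ℓ′ , u′) , peak′ ← lowest proj₁ (start L′)
          return ([ (λ ℓ≤ℓ′ → inj₂ (below-≤ L′ L x′≢0 peak′ peak ℓ≤ℓ′))
                  , (λ ℓ′≤ℓ → inj₁ (below-≤ L L′ x≢0 peak peak′ ℓ′≤ℓ)) ]′ (≤-total (pos ℓ) (pos ℓ′)))
          where
          start : ∀ {v d x y} (L : Located v d x y) →
                  ∃ λ (ℓ , u) → Reach ℓ m × Bag ℓ u × Nearest (Located.w L) v d u
          start L = let u , near-u = Located.nearest L in
            (u , u) , reach-trans (proj₁ (proj₁ near-u)) (Located.w⊑m L) , bag-self , near-u

        not-below-comparable : y ≢ 0 → y′ ≢ 0 →
          ¬ ¬ Comparable (λ i → ¬ Reach m (α i) × Connected m (α i)) v v′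
        not-below-comparable y≢0 y′≢0 = do
          u , peak ← minimal pos (Located.nearest L)
          u′ , peak′ ← minimal pos (Located.nearest L′)
          return ([ (λ u≤u′ → inj₁ λ i (p , c) → not-below-≤ L L′ y≢0 peak peak′ u≤u′ i p c)
                  , (λ u′≤u → inj₂ λ i (p , c) → not-below-≤ L′ L y′≢0 peak′ peak u′≤u i p c) ]′
                  (≤-total (pos u) (pos u′)))

    locate : ∀ v i → Connected v (α i) → ∀ (J : Fin k → V) →
      (∀ w i → Reach w (α i) → ¬ ¬ ∃ λ c → SameClass w ([ α , J ]′ c)) → ∀ (frames : ∀ m → Frame m) →
      ¬ ¬ ∃ λ c → ∃₂ λ d x → ∃ λ y → Located (frames ([ α , J ]′ c)) v d x y
    locate v i (_ , p) J below frames = do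
      w , (w⊑v , i , w⊑i) , w-lowest ← lowest id (meet p)
      c , class ← below w i w⊑i
      let F = frames ([ α , J ]′ c)
      u , bag-u , least ← minimal (δ v) {P = Bag w} (w , bag-self)
      let near = u , bag-u , refl
      x , x-dist ← setDistance {K = Bag ([ α , J ]′ c)} near (_ , bag-self)
      y , y-dist ← setDistance {K = Bag (Frame.top F)} near (_ , bag-self)
      return (c , δ v u , x , y , record
        { w⊑v = w⊑v
        ; class = class
        ; w-lowest = λ z i z⊑v z⊑i → w-lowest z (z⊑v , i , z⊑i)
        ; d≤ = least
        ; nearest = near
        ; bottom-dist = x-dist
        ; top-dist = y-dist
        })
      where
      -- Neighbours are comparable in the forest, so a common ancestor with an `α i` can be carried
      -- back along the walk to `v`.
      meet : ∀ {v i ℓ} → Walk v (α i) ℓ → ∃ λ w → Reach w v × ∃ λ i → Reach w (α i)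
      meet {i = i} Distance.[] = _ , here , i , here
      meet (e Distance.∷ p) with meet p | ~⇒comparable e
      ... | z , z⊑u , i , z⊑i | inj₂ u⊑v = z , reach-trans z⊑u u⊑v , i , z⊑i
      ... | z , z⊑u , i , z⊑i | inj₁ v⊑u with reach-chain z⊑u v⊑u
      ...   | inj₁ z⊑v = z , z⊑v , i , z⊑i
      ...   | inj₂ v⊑z = _ , here , i , reach-trans v⊑z z⊑i

-- Chains of bit vectors

sum : ∀ {k} → (Fin k → ℕ) → ℕ
sum {zero}  f = 0
sum {suc k} f = f zero + sum (f ∘ suc)

sum-mono : ∀ {k} {f g : Fin k → ℕ} → (∀ i → f i ≤ g i) → sum f ≤ sum g
sum-mono {zero}  f≤g = z≤n
sum-mono {suc k} f≤g = +-mono-≤ (f≤g zero) (sum-mono (f≤g ∘ suc))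

sum-≤1 : ∀ {k} {f : Fin k → ℕ} → (∀ i → f i ≤ 1) → sum f ≤ k
sum-≤1 {zero}  f≤1 = z≤n
sum-≤1 {suc k} f≤1 = +-mono-≤ (f≤1 zero) (sum-≤1 (f≤1 ∘ suc))

-- This lets a member of a chain be coded by one number: a strict inequality anywhere would show in
-- the sum.
≤∧sum≡⇒≗ : ∀ {k} {f g : Fin k → ℕ} → (∀ i → f i ≤ g i) → sum f ≡ sum g → ∀ i → f i ≡ g i
≤∧sum≡⇒≗ {suc k} {f} {g} f≤g eq i with m≤n⇒m<n∨m≡n (f≤g zero)
... | inj₁ f0<g0 = contradiction eq (<⇒≢ (+-mono-<-≤ f0<g0 (sum-mono (f≤g ∘ suc))))
≤∧sum≡⇒≗ {suc k} {f} {g} f≤g eq zero    | inj₂ f0≡g0 = f0≡g0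
≤∧sum≡⇒≗ {suc k} {f} {g} f≤g eq (suc i) | inj₂ f0≡g0 =
  ≤∧sum≡⇒≗ (f≤g ∘ suc)
    (+-cancelˡ-≡ (f zero) _ _ (trans eq (cong (_+ sum (g ∘ suc)) (sym f0≡g0)))) i

-- Equals `f ∸ s` when `s ≤ f ≤ suc s`; the cut at 1 keeps it a bit for all arguments.
bit : ℕ → ℕ → ℕ
bit s f = (f ∸ s) ⊓ 1

bit-≤1 : ∀ s f → bit s f ≤ 1
bit-≤1 s f = m⊓n≤n (f ∸ s) 1

bit-mono : ∀ s {f g} → f ≤ g → bit s f ≤ bit s g
bit-mono s f≤g = ⊓-monoˡ-≤ 1 (∸-monoˡ-≤ s f≤g)

bit-injective : ∀ {s f g} → s ≤ f × f ≤ suc s → s ≤ g × g ≤ suc s → bit s f ≡ bit s g → f ≡ g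
bit-injective {s} {f} {g} (s≤f , f≤) (s≤g , g≤) eq = ∸-cancelʳ-≡ s≤f s≤g
  (trans (sym (unfold f≤)) (trans eq (unfold g≤)))
  where
  unfold : ∀ {h} → h ≤ suc s → bit s h ≡ h ∸ s
  unfold {h} h≤ = m≤n⇒m⊓n≡m (≤-trans (∸-monoˡ-≤ s h≤) (≤-reflexive (m+n∸n≡m 1 s)))

module _ {k : ℕ} {P : Fin k → Set} (P? : U.Decidable P) where

  excess : (s f : Fin k → ℕ) → Fin k → ℕ
  excess s f i = if Dec.does (P? i) then bit (s i) (f i) else 0

  excess-≤1 : ∀ s f i → excess s f i ≤ 1
  excess-≤1 s f i with P? i
  ... | yes _ = bit-≤1 (s i) (f i)
  ... | no _  = z≤n

  excess-determines : ∀ {s s′ f f′} → (∀ i → P i → s i ≡ s′ i) →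
    (∀ i → P i → s i ≤ f i × f i ≤ suc (s i)) → (∀ i → P i → s′ i ≤ f′ i × f′ i ≤ suc (s′ i)) →
    (∀ i → P i → f i ≤ f′ i) → sum (excess s f) ≡ sum (excess s′ f′) → ∀ i → P i → f i ≡ f′ i
  excess-determines {s} {s′} {f} {f′} s≡s′ near near′ f≤f′ eq i pi =
    bit-injective (near i pi) (subst (λ t → t ≤ f′ i × f′ i ≤ suc t) (sym (s≡s′ i pi)) (near′ i pi)) (begin
      bit (s i) (f i)    ≡⟨ excess-on s f pi ⟨
      excess s f i       ≡⟨ ≤∧sum≡⇒≗ excess-mono eq i ⟩
      excess s′ f′ i     ≡⟨ excess-on s′ f′ pi ⟩
      bit (s′ i) (f′ i)  ≡⟨ cong (λ t → bit t (f′ i)) (s≡s′ i pi) ⟨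
      bit (s i) (f′ i)   ∎)
    where
    open ≡-Reasoning
    excess-on : ∀ s f {i} → P i → excess s f i ≡ bit (s i) (f i)
    excess-on s f {i} pi with P? i
    ... | yes _  = refl
    ... | no ¬pi = contradiction pi ¬pi

    excess-mono : ∀ i → excess s f i ≤ excess s′ f′ i
    excess-mono i with P? i
    ... | yes pi = subst (λ t → bit (s i) (f i) ≤ bit t (f′ i)) (s≡s′ i pi) (bit-mono (s i) (f≤f′ i pi))
    ... | no _   = z≤n

  comparable-excess-determines : ∀ {s s′ f f′} → (∀ i → P i → s i ≡ s′ i) →
    (∀ i → P i → s i ≤ f i × f i ≤ suc (s i)) → (∀ i → P i → s′ i ≤ f′ i × f′ i ≤ suc (s′ i)) →
    (∀ i → P i → f i ≤ f′ i) ⊎ (∀ i → P i → f′ i ≤ f i) →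
    sum (excess s f) ≡ sum (excess s′ f′) → ∀ i → P i → f i ≡ f′ i
  comparable-excess-determines s≡s′ near near′ (inj₁ f≤f′) eq i pi = excess-determines s≡s′ near near′ f≤f′ eq i pi
  comparable-excess-determines s≡s′ near near′ (inj₂ f′≤f) eq i pi =
    sym (excess-determines (λ j pj → sym (s≡s′ j pj)) near′ near f′≤f (sym eq) i pi)

-- The finite set of codes

toFin : ∀ {m o} → m < o → ∃ λ (i : Fin o) → toℕ i ≡ m
toFin m<o = fromℕ< m<o , Fin.toℕ-fromℕ< m<o

-- Cutting off at `suc r` keeps the value `r` apart from the values beyond the cap.
⊓-equal : ∀ {a b r} → a ⊓ suc r ≡ b ⊓ suc r → a ≡ b ⊎ (r < a × r < b)
⊓-equal {a} {b} {r} eq with a ≤? r | b ≤? r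
... | yes a≤r | yes b≤r =
  inj₁ (trans (sym (m≤n⇒m⊓n≡m (m≤n⇒m≤1+n a≤r))) (trans eq (m≤n⇒m⊓n≡m (m≤n⇒m≤1+n b≤r))))
... | no a≰r  | no b≰r  = inj₂ (≰⇒> a≰r , ≰⇒> b≰r)
... | yes a≤r | no b≰r  = contradiction
  (trans (sym (m≤n⇒m⊓n≡m (m≤n⇒m≤1+n a≤r))) (trans eq (m≥n⇒m⊓n≡n (≰⇒> b≰r)))) (<⇒≢ (s≤s a≤r))
... | no a≰r  | yes b≤r = contradiction
  (trans (sym (m≤n⇒m⊓n≡m (m≤n⇒m≤1+n b≤r))) (trans (sym eq) (m≥n⇒m⊓n≡n (≰⇒> a≰r)))) (<⇒≢ (s≤s b≤r))

-- The factors `1 + r` hold `d` and, in the second case, `x`; `6` holds the offset, `2 + r` the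
-- value of `y` cut off at `1 + r`, `2 ^ k` a bit vector and `1 + k` a number of ones.
ClassCode : ℕ → ℕ → Set
ClassCode r k =
  (Fin 2 × Fin (1 + r) × Fin 6 × Fin (2 ^ k)) ⊎
  (Fin (1 + r) × Fin (1 + r) × Fin 6 × Fin (1 + k) × Fin (1 + k)) ⊎
  (Fin (1 + r) × Fin (2 + r) × Fin (1 + k))

pattern near c    = inj₁ c
pattern between c = inj₂ (inj₁ c)
pattern far c     = inj₂ (inj₂ c)

Code : ℕ → ℕ → Set
Code r k = (Fin k ⊎ Fin k) × ClassCode r k

codes : ℕ → ℕ → ℕ
codes r k = (k + k) *
  (2 * ((1 + r) * (6 * 2 ^ k)) +
   ((1 + r) * ((1 + r) * (6 * ((1 + k) * (1 + k)))) + (1 + r) * ((2 + r) * (1 + k))))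

Code-finite : ∀ r k → Fin (codes r k) ↔ Code r k
Code-finite r k = Fin.+↔⊎ ×↔
  ((↔-refl ×↔ ↔-refl ×↔ Fin.*↔×) +↔
   (↔-refl ×↔ ↔-refl ×↔ ↔-refl ×↔ Fin.*↔×) +↔
   (↔-refl ×↔ Fin.*↔×))
  where
  infixr 5 _×↔_
  infixr 4 _+↔_
  _×↔_ : ∀ {m n} {A B : Set} → Fin m ↔ A → Fin n ↔ B → Fin (m * n) ↔ (A × B)
  p ×↔ q = ↔-trans Fin.*↔× (p ×-↔ q)

  _+↔_ : ∀ {m n} {A B : Set} → Fin m ↔ A → Fin n ↔ B → Fin (m + n) ↔ (A ⊎ B)
  p +↔ q = ↔-trans Fin.+↔⊎ (p ⊎-↔ q)

-- Encoding vertices; equal codes give equal profiles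

module Coding (G : Graph n) {pos : Fin n → ℕ} (elim : Elimination.IsElimination G pos) (r : ℕ) where
  open Cycles G using (V)
  open Reachability G pos
  open Distance G hiding ([]; _∷_)
  open CliqueForest G elim
  open Classes G elim

  module _ {k : ℕ} (α : Fin k → V) where

    Agree : V → V → Set
    Agree v v′ = ∀ i → Cap r (dist G (α i) v) ≡ Cap r (dist G (α i) v′)

    module _ {m : V} (F : Frame α m) where
      open Frame F

      -- For `α i` connected to `m`, the smaller of the two possible distances.
      start : ℕ → ℕ → ℕ → Fin k → ℕ
      start d x y i with below? i
      ... | yes _ = d + x + proj₁ (bottom-distance i)
      ... | no _  = d + y + proj₁ (top-distance i)

      Aside : Fin k → Set
      Aside i = ¬ Reach m (α i) × Connected m (α i)

      aside? : U.Decidable Aside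
      aside? i = ¬? (below? i) ×-dec connected? m (α i)

      -- By `span-≤` the subtraction is exact, and by `span-≥` the result is at most 5.
      offset : ℕ → ℕ → ℕ
      offset x y = 3 + (x + y) ∸ δ m top

      countBelow countAside : V → ℕ → ℕ → ℕ → ℕ
      countBelow v d x y = sum (excess below? (start d x y) (δ v ∘ α))
      countAside v d x y = sum (excess aside? (start d x y) (δ v ∘ α))

      start-below : ∀ {d x y y′} i → Reach m (α i) → start d x y i ≡ start d x y′ i
      start-below i m⊑i with below? i
      ... | yes _  = refl
      ... | no m⋢i = contradiction m⊑i m⋢i

      start-aside : ∀ {d x x′ y} i → Aside i → start d x y i ≡ start d x′ y i
      start-aside i (m⋢i , _) with below? i
      ... | yes m⊑i = contradiction m⊑i m⋢i
      ... | no _    = refl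

      start-≥ : ∀ d x y i → d ≤ start d x y i
      start-≥ d x y i with below? i
      ... | yes _ = ≤-trans (m≤m+n d x) (m≤m+n (d + x) _)
      ... | no _  = ≤-trans (m≤m+n d y) (m≤m+n (d + y) _)

      start-below-≥ : ∀ d x y i → Reach m (α i) → x ≤ start d x y i
      start-below-≥ d x y i m⊑i with below? i
      ... | yes _  = ≤-trans (m≤n+m x d) (m≤m+n (d + x) _)
      ... | no m⋢i = contradiction m⊑i m⋢i

      start-aside-≥ : ∀ d x y i → Aside i → y ≤ start d x y i
      start-aside-≥ d x y i (m⋢i , _) with below? i
      ... | yes m⊑i = contradiction m⊑i m⋢i
      ... | no _    = ≤-trans (m≤n+m y d) (m≤m+n (d + y) _)

      module _ {v d x y} (L : Located α F v d x y) where
        open Located L hiding (d≤)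

        start-near : ∀ i → Connected m (α i) → start d x y i ≤ δ v (α i) × δ v (α i) ≤ suc (start d x y i)
        start-near i c with below? i
        ... | yes m⊑i = distance-below m⊑i (proj₂ (bottom-distance i))
        ... | no m⋢i  = distance-not-below m⋢i c (proj₂ (top-distance i))

        offset-<6 : offset x y < 6
        offset-<6 = s≤s (begin
          3 + (x + y) ∸ δ m top         ≤⟨ ∸-monoˡ-≤ (δ m top) (s≤s (s≤s (s≤s span-≥))) ⟩
          5 + δ m top ∸ δ m top         ≡⟨ m+n∸n≡m 5 (δ m top) ⟩
          5                             ∎)
          where open ≤-Reasoning

        d≤distance : ∀ i → d ≤ δ v (α i)
        d≤distance i = decidable-stable (_ ≤? _) do
          yes c ← em {A = Connected m (α i)}
            -- At infinite distance `δ` takes the value `n`, which bounds every value of `δ`, in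
            -- particular `d`.
            where no ¬c → return (≤-trans (≤-trans (proj₂ nearest-≤) (δ≤n v _))
                                    (≤-reflexive (sym (disconnected⇒δ≡n (¬c ∘ connected-trans (connected-sym connected))))))
          return (≤-trans (start-≥ d x y i) (proj₁ (start-near i c)))
          where
          nearest-≤ : ∃ λ u → d ≤ δ v u
          nearest-≤ = let u , _ , eq = nearest in u , ≤-reflexive (sym eq)

      offset-injective : ∀ {v v′ d d′ x x′ y y′} → Located α F v d x y → Located α F v′ d′ x′ y′ →
                         offset x y ≡ offset x′ y′ → x + y ≡ x′ + y′
      offset-injective L L′ eq = +-cancelˡ-≡ 3 _ _ (∸-cancelʳ-≡ (Located.span-≤ L) (Located.span-≤ L′) eq)

      module _ {v v′ d d′ x x′ y y′} (L : Located α F v d x y) (L′ : Located α F v′ d′ x′ y′) where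

        agree : (∀ i → Reach m (α i) → δ v (α i) ≡ δ v′ (α i) ⊎ (r < δ v (α i) × r < δ v′ (α i))) →
                (∀ i → Aside i → δ v (α i) ≡ δ v′ (α i) ⊎ (r < δ v (α i) × r < δ v′ (α i))) → Agree v v′
        agree on-below on-aside i = decidable-stable (_ ≟∞ _) do
          yes c ← em {A = Connected m (α i)}
            where no ¬c → return (trans
                    (cap-disconnected (λ c → ¬c (connected-sym (connected-trans c (Located.connected L)))))
                    (sym (cap-disconnected λ c → ¬c (connected-sym (connected-trans c (Located.connected L′))))))
          yes m⊑i ← em {A = Reach m (α i)}
            where no m⋢i → return (conclude c (on-aside i (m⋢i , c)))
          return (conclude c (on-below i m⊑i))
          where
          conclude : Connected m (α i) → δ v (α i) ≡ δ v′ (α i) ⊎ (r < δ v (α i) × r < δ v′ (α i)) →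
                     Cap r (dist G (α i) v) ≡ Cap r (dist G (α i) v′)
          conclude c (inj₁ eq) = cap-cong
            (connected-sym (connected-trans (Located.connected L) c))
            (connected-sym (connected-trans (Located.connected L′) c))
            (trans (δ-sym (α i) v) (trans eq (δ-sym v′ (α i))))
          conclude c (inj₂ (r<δ , r<δ′)) = trans
            (cap-far (subst (r <_) (δ-sym v (α i)) r<δ))
            (sym (cap-far (subst (r <_) (δ-sym v′ (α i)) r<δ′)))

      module _ {v v′ d x x′ y y′} (L : Located α F v d x y) (L′ : Located α F v′ d x′ y′) where

        below-agree : x ≡ x′ → x ≢ 0 → countBelow v d x y ≡ countBelow v′ d x′ y′ →
                      ∀ i → Reach m (α i) → δ v (α i) ≡ δ v′ (α i)
        below-agree refl x≢0 eq i m⊑i = decidable-stable (_ ≟ _) do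
          cmp ← below-comparable α F L L′ x≢0 x≢0
          return (comparable-excess-determines below? (start-below {d} {x})
            (λ j m⊑j → start-near L j (reach⇒connected m⊑j))
            (λ j m⊑j → start-near L′ j (reach⇒connected m⊑j)) cmp eq i m⊑i)

        aside-agree : y ≡ y′ → y ≢ 0 → countAside v d x y ≡ countAside v′ d x′ y′ →
                      ∀ i → Aside i → δ v (α i) ≡ δ v′ (α i)
        aside-agree refl y≢0 eq i as = decidable-stable (_ ≟ _) do
          cmp ← not-below-comparable α F L L′ y≢0 y≢0
          return (comparable-excess-determines aside? start-aside
            (λ j (_ , c) → start-near L j c) (λ j (_ , c) → start-near L′ j c) cmp eq i as)

      bits : V → ℕ → ℕ → ℕ → Fin k → Fin 2
      bits v d x y i = fromℕ< (s≤s (bit-≤1 (start d x y i) (δ v (α i))))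

      bits-agree : ∀ {v v′ d x y} → Located α F v d x y → Located α F v′ d x y →
        funToFin (bits v d x y) ≡ funToFin (bits v′ d x y) → Agree v v′
      bits-agree {v} {v′} {d} {x} {y} L L′ eq =
        agree L L′ (λ i m⊑i → inj₁ (same i (reach⇒connected m⊑i))) (λ i (_ , c) → inj₁ (same i c))
        where
        same : ∀ i → Connected m (α i) → δ v (α i) ≡ δ v′ (α i)
        same i c = bit-injective (start-near L i c) (start-near L′ i c)
          (Fin.fromℕ<-injective _ _ (s≤s (bit-≤1 (start d x y i) (δ v (α i)))) (s≤s (bit-≤1 (start d x y i) (δ v′ (α i)))) (begin
            bits v d x y i                      ≡⟨ Fin.finToFun-funToFin (bits v d x y) i ⟨
            finToFun (funToFin (bits v d x y)) i  ≡⟨ cong (λ b → finToFun b i) eq ⟩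
            finToFun (funToFin (bits v′ d x y)) i ≡⟨ Fin.finToFun-funToFin (bits v′ d x y) i ⟩
            bits v′ d x y i                     ∎))
          where
          open ≡-Reasoning

      -- Codes of vertices with x = 0, with y = 0, with 0 < x ≤ r and 0 < y, and
      -- with r < x and 0 < y.  In the first three cases the offset yields the
      -- remaining one of x and y; in the last one the α i below m are too far.
      Coded : V → ClassCode r k → Set
      Coded v (near (zero , d , o , b)) = ∃ λ y →
        Located α F v (toℕ d) 0 y × toℕ o ≡ offset 0 y × b ≡ funToFin (bits v (toℕ d) 0 y)
      Coded v (near (suc _ , d , o , b)) = ∃ λ x →
        Located α F v (toℕ d) x 0 × toℕ o ≡ offset x 0 × b ≡ funToFin (bits v (toℕ d) x 0)
      Coded v (between (d , x , o , a , b)) = ∃ λ y →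
        Located α F v (toℕ d) (toℕ x) y × toℕ x ≢ 0 × y ≢ 0 × toℕ o ≡ offset (toℕ x) y ×
        toℕ a ≡ countBelow v (toℕ d) (toℕ x) y × toℕ b ≡ countAside v (toℕ d) (toℕ x) y
      Coded v (far (d , z , b)) = ∃₂ λ x y →
        Located α F v (toℕ d) x y × r < x × y ≢ 0 ×
        toℕ z ≡ y ⊓ (1 + r) × toℕ b ≡ countAside v (toℕ d) x y

      encode : ∀ {v d x y} → Located α F v d x y → d ≤ r → ∃ (Coded v)
      encode {v} {d} {x} {y} L d≤r with toFin (s≤s d≤r) | toFin (offset-<6 L) | x ≟ 0 | y ≟ 0 | x ≤? r
      ... | d̂ , refl | o , o≡ | yes refl | _        | _       = near (zero , d̂ , o , _) , y , L , o≡ , refl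
      ... | d̂ , refl | o , o≡ | no _     | yes refl | _       = near (suc zero , d̂ , o , _) , x , L , o≡ , refl
      ... | d̂ , refl | o , o≡ | no x≢0   | no y≢0   | yes x≤r
        with toFin (s≤s x≤r) | toFin (s≤s (count-≤ below? (start d x y))) | toFin (s≤s (count-≤ aside? (start d x y)))
        where
        count-≤ : ∀ {P : Fin k → Set} (P? : U.Decidable P) s → sum (excess P? s (δ v ∘ α)) ≤ k
        count-≤ P? s = sum-≤1 (excess-≤1 P? s (δ v ∘ α))
      ...   | x̂ , refl | a , a≡ | b , b≡ = between (d̂ , x̂ , o , a , b) , y , L , x≢0 , y≢0 , o≡ , a≡ , b≡
      encode {v} {d} {x} {y} L d≤r | d̂ , refl | _ | no _ | no y≢0 | no x≰r
        with toFin (s≤s (m⊓n≤n y (1 + r))) | toFin (s≤s (sum-≤1 (excess-≤1 aside? (start d x y) (δ v ∘ α))))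
      ... | z , z≡ | b , b≡ = far (d̂ , z , b) , x , y , L , ≰⇒> x≰r , y≢0 , z≡ , b≡

      coded-agree : ∀ {v v′} c → Coded v c → Coded v′ c → Agree v v′
      coded-agree (near (zero , d , o , b)) (y , L , o≡ , b≡) (y′ , L′ , o≡′ , b≡′)
        with refl ← offset-injective L L′ (trans (sym o≡) o≡′) =
        bits-agree L L′ (trans (sym b≡) b≡′)
      coded-agree (near (suc _ , d , o , b)) (x , L , o≡ , b≡) (x′ , L′ , o≡′ , b≡′)
        with refl ← +-cancelʳ-≡ 0 x x′ (offset-injective L L′ (trans (sym o≡) o≡′)) =
        bits-agree L L′ (trans (sym b≡) b≡′)
      coded-agree (between (d , x , o , a , b))
        (y , L , x≢0 , y≢0 , o≡ , a≡ , b≡) (y′ , L′ , _ , _ , o≡′ , a≡′ , b≡′) =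
        agree L L′
          (λ i m⊑i → inj₁ (below-agree L L′ refl x≢0 (trans (sym a≡) a≡′) i m⊑i))
          (λ i as → inj₁ (aside-agree L L′ y≡y′ y≢0 (trans (sym b≡) b≡′) i as))
        where
        y≡y′ : y ≡ y′
        y≡y′ = +-cancelˡ-≡ (toℕ x) y y′ (offset-injective L L′ (trans (sym o≡) o≡′))
      coded-agree {v} {v′} (far (d , z , b))
        (x , y , L , r<x , y≢0 , z≡ , b≡) (x′ , y′ , L′ , r<x′ , _ , z≡′ , b≡′) =
        agree L L′ (λ i m⊑i → inj₂ (below-far L r<x i m⊑i , below-far L′ r<x′ i m⊑i)) on-aside
        where
        below-far : ∀ {v d x y} → Located α F v d x y → r < x → ∀ i → Reach m (α i) → r < δ v (α i)
        below-far {d = d} {x} {y} L r<x i m⊑i =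
          <-≤-trans r<x (≤-trans (start-below-≥ d x y i m⊑i) (proj₁ (start-near L i (reach⇒connected m⊑i))))

        aside-far : ∀ {v d x y} → Located α F v d x y → r < y → ∀ i → Aside i → r < δ v (α i)
        aside-far {d = d} {x} {y} L r<y i as =
          <-≤-trans r<y (≤-trans (start-aside-≥ d x y i as) (proj₁ (start-near L i (proj₂ as))))

        on-aside : ∀ i → Aside i → δ v (α i) ≡ δ v′ (α i) ⊎ (r < δ v (α i) × r < δ v′ (α i))
        on-aside i as with ⊓-equal (trans (sym z≡) z≡′)
        ... | inj₁ y≡y′ = inj₁ (aside-agree L L′ y≡y′ y≢0 (trans (sym b≡) b≡′) i as)
        ... | inj₂ (r<y , r<y′) = inj₂ (aside-far L r<y i as , aside-far L′ r<y′ i as)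

    module _ (J : Fin k → V) (frames : ∀ m → Frame α m) where

      CodedIn : V → Code r k → Set
      CodedIn v (c , code) = Coded (frames ([ α , J ]′ c)) v code

      coded : (∀ w i → Reach w (α i) → ¬ ¬ ∃ λ c → SameClass α w ([ α , J ]′ c)) →
              ∀ v i → Connected v (α i) → δ v (α i) ≤ r → ¬ ¬ ∃ (CodedIn v)
      coded below v i conn close = do
        c , d , x , y , L ← locate α v i conn J below frames
        let F = frames ([ α , J ]′ c)
            code , h = encode F L (≤-trans (d≤distance F L i) close)
        return ((c , code) , h)

      codedIn-agree : ∀ {v v′} c → CodedIn v c → CodedIn v′ c → Agree v v′
      codedIn-agree (c , code) = coded-agree (frames ([ α , J ]′ c)) code

-- Counting the profiles

deduplicate-distinct : {R : Rel A 0ℓ} (R? : B.Decidable R) → ∀ xs →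
  AllPairs (λ x y → ¬ R x y) (List.deduplicate R? xs)
deduplicate-distinct R? []       = AllPairs.[]
deduplicate-distinct R? (x ∷ xs) =
  ListAll.all-filter _ (List.deduplicate R? xs) AllPairs.∷ AllPairs.filter⁺ _ (deduplicate-distinct R? xs)

allPairs-lookup : {R : Rel A 0ℓ} {xs : List A} → AllPairs R xs →
  ∀ {i j} → i Fin.< j → R (List.lookup xs i) (List.lookup xs j)
allPairs-lookup (px AllPairs.∷ _)  {zero}  {suc j} _         = ListAll.lookup px (∈-lookup j)
allPairs-lookup (_ AllPairs.∷ pxs) {suc i} {suc j} (s≤s i<j) = allPairs-lookup pxs i<j

elements : (A : Subset n) → ∃ λ (α : Fin ∣ A ∣ → Fin n) → ∀ {a} → a Subset.∈ A → ∃ λ i → α i ≡ a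
elements []           = (λ ()) , λ ()
elements (inside ∷ A) = let α , onto = elements A in
  (λ { zero → zero ; (suc i) → suc (α i) }) ,
  λ { Vec.here → zero , refl ; (Vec.there a∈A) → let i , eq = onto a∈A in suc i , cong suc eq }
elements (outside ∷ A) = let α , onto = elements A in
  suc ∘ α , λ { (Vec.there a∈A) → let i , eq = onto a∈A in i , cong suc eq }

module _ (G : Graph n) (chordal : Chordal G) (r : ℕ) (A : Subset n) where
  open Elimination G
  open Distance G hiding ([]; _∷_)

  private
    α : Fin ∣ A ∣ → Fin n
    α = proj₁ (elements A)

    profiles : List (Profile A)
    profiles = List.deduplicate _≈?_ (filter (λ p → ¬? (p ≈? const∞)) (List.map (λ v → profile r G v A) (allFin n)))

    ≈-from-elements : ∀ {p q : Fin n → ℕ∞} → (∀ i → p (α i) ≡ q (α i)) →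
      ∀ a → .(a Subset.∈ A) → p a ≡ q a
    ≈-from-elements eq a a∈A with proj₂ (elements A) (recompute (a ∈? A) a∈A)
    ... | i , refl = eq i

    vertex : ∀ i → ∃ λ v → List.lookup profiles i ≡ profile r G v A × ¬ (_≈_ {A = A} (profile r G v A) const∞)
    vertex i with ∈-filter⁻ _ {xs = List.map (λ v → profile r G v A) (allFin n)} (∈-deduplicate⁻ _≈?_ _ (∈-lookup i))
    ... | p∈ , p≉∞ with ∈-map⁻ (λ v → profile r G v A) p∈
    ...   | v , _ , eq = v , eq , subst (λ p → ¬ (p ≈ const∞)) eq p≉∞

    -- The exclusion of the constant profile enters here: the element found makes `locate`
    -- applicable and bounds `d` by `r`.
    close-element : ∀ {v} → ¬ (_≈_ {A = A} (profile r G v A) const∞) →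
                    ¬ ¬ ∃ λ i → Connected v (α i) × δ v (α i) ≤ r
    close-element {v} p≉∞ = do
      yes close ← em {A = ∃ λ i → Connected v (α i) × δ v (α i) ≤ r}
        where no ∄ → λ _ → p≉∞ (≈-from-elements {q = λ _ → ∞} (all-far ∄))
      return close
      where
      all-far : ¬ (∃ λ i → Connected v (α i) × δ v (α i) ≤ r) → ∀ i → Cap r (dist G (α i) v) ≡ ∞
      all-far ∄ i with connected? v (α i) | δ v (α i) ≤? r
      ... | no ¬c | _       = cap-disconnected (¬c ∘ connected-sym)
      ... | yes c | yes δ≤r = contradiction (i , c , δ≤r) ∄
      ... | yes _ | no δ≰r  = cap-far (subst (r <_) (δ-sym v (α i)) (≰⇒> δ≰r))

  -- Pigeonhole: with more profiles than codes, two entries of the deduplicated list would share a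
  -- code and hence agree.
  profileCount-≤ : profileCount r G A ≤ codes r ∣ A ∣
  profileCount-≤ = decidable-stable (_ ≤? _) do
    pos , elim ← elimination chordal
    J , below ← Classes.bottoms G elim α
    frames ← ¬¬-choice (Classes.frame G elim α)
    let open Coding G elim r
    code ← ¬¬-choice λ i → do
      j , c , close ← close-element (proj₂ (proj₂ (vertex i)))
      coded α J frames below (proj₁ (vertex i)) j c close
    return (≮⇒≥ λ codes<count →
      let to-fin = Inverse.from (Code-finite r ∣ A ∣)
          i , j , i<j , eq = Fin.pigeonhole codes<count (to-fin ∘ proj₁ ∘ code)
          code≡ = begin
            proj₁ (code i)                                            ≡⟨ Inverse.strictlyInverseˡ (Code-finite r ∣ A ∣) _ ⟨
            Inverse.to (Code-finite r ∣ A ∣) (to-fin (proj₁ (code i))) ≡⟨ cong (Inverse.to (Code-finite r ∣ A ∣)) eq ⟩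
            Inverse.to (Code-finite r ∣ A ∣) (to-fin (proj₁ (code j))) ≡⟨ Inverse.strictlyInverseˡ (Code-finite r ∣ A ∣) _ ⟩
            proj₁ (code j)                                            ∎
          agree = codedIn-agree α J frames (proj₁ (code j))
            (subst (CodedIn α J frames (proj₁ (vertex i))) code≡ (proj₂ (code i))) (proj₂ (code j))
      in allPairs-lookup (deduplicate-distinct _≈?_ (filter (λ p → ¬? (p ≈? const∞)) (List.map (λ v → profile r G v A) (allFin n)))) i<j
           (subst₂ _≈_ (sym (proj₁ (proj₂ (vertex i)))) (sym (proj₁ (proj₂ (vertex j)))) (≈-from-elements agree)))
    where open ≡-Reasoning

-- The numerical estimate and the theorem

codes-≤ : ∀ r k → 1 ≤ r → 1 ≤ k → codes r k ≤ 216 * k * (r * 2 ^ k + r ^ 2 * k ^ 2)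
codes-≤ r k 1≤r 1≤k = begin
  codes r k
    ≤⟨ *-monoʳ-≤ (k + k) (+-mono-≤
         (*-monoʳ-≤ 2 (*-monoˡ-≤ (6 * 2 ^ k) 1+r≤))
         (+-mono-≤
           (*-mono-≤ 1+r≤ (*-mono-≤ 1+r≤ (*-monoʳ-≤ 6 (*-mono-≤ 1+k≤ 1+k≤))))
           (*-mono-≤ 1+r≤ (*-mono-≤ (+-mono-≤ 1≤r 1+r≤) 1+k≤)))) ⟩
  (k + k) * (2 * ((r + r) * (6 * 2 ^ k)) +
    ((r + r) * ((r + r) * (6 * ((k + k) * (k + k)))) + (r + r) * ((r + (r + r)) * (k + k))))
    ≤⟨ *-monoʳ-≤ (k + k) (+-monoʳ-≤ (2 * ((r + r) * (6 * 2 ^ k)))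
         (+-monoʳ-≤ ((r + r) * ((r + r) * (6 * ((k + k) * (k + k)))))
         (*-monoʳ-≤ (r + r) (*-monoʳ-≤ (r + (r + r)) 2k≤)))) ⟩
  (k + k) * (2 * ((r + r) * (6 * 2 ^ k)) +
    ((r + r) * ((r + r) * (6 * ((k + k) * (k + k)))) + (r + r) * ((r + (r + r)) * ((k + k) * k))))
    -- The coefficients are now 48 at `k * (r * 2 ^ k)` and `2 * (96 + 12) = 216` at
    -- `k * (r ^ 2 * k ^ 2)`; adding `14 * 12 = 168` to the first makes them equal.
    ≤⟨ m≤m+n _ (14 * (12 * (k * (r * 2 ^ k)))) ⟩
  (k + k) * (2 * ((r + r) * (6 * 2 ^ k)) +
    ((r + r) * ((r + r) * (6 * ((k + k) * (k + k)))) + (r + r) * ((r + (r + r)) * ((k + k) * k)))) +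
    14 * (12 * (k * (r * 2 ^ k)))
    ≡⟨ expand r k (2 ^ k) ⟩
  216 * k * (r * 2 ^ k + r ^ 2 * k ^ 2) ∎
  where
  open ≤-Reasoning
  1+r≤ : 1 + r ≤ r + r
  1+r≤ = +-monoˡ-≤ r 1≤r

  1+k≤ : 1 + k ≤ k + k
  1+k≤ = +-monoˡ-≤ k 1≤k

  2k≤ : k + k ≤ (k + k) * k
  2k≤ = ≤-trans (≤-reflexive (sym (*-identityʳ (k + k)))) (*-monoʳ-≤ (k + k) 1≤k)

  expand : ∀ r k p →
    (k + k) * (2 * ((r + r) * (6 * p)) +
      ((r + r) * ((r + r) * (6 * ((k + k) * (k + k)))) + (r + r) * ((r + (r + r)) * ((k + k) * k)))) +
      14 * (12 * (k * (r * p))) ≡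
    6 * 36 * k * (r * p + r * (r * 1) * (k * (k * 1)))
  expand = solve-∀

theorem10 : ∃ λ (C : ℕ) → 0 < C ×
    (∀ (n : ℕ) (G : Graph n) → Chordal G →
    ∀ (r : ℕ) → 1 ≤ r → ∀ (k : ℕ) → 1 ≤ k → k ≤ n →
    profileComplexity r G k ≤ C * k * (r * 2 ^ k + r ^ 2 * k ^ 2))
theorem10 = 216 , s≤s z≤n , λ n G chordal r 1≤r k 1≤k _ →
  max≤v⁺ z≤n (ListAll.map⁺ (ListAll.map
    (λ { {A} refl → ≤-trans (profileCount-≤ G chordal r A) (codes-≤ r k 1≤r 1≤k) })
    (ListAll.all-filter (λ A → ∣ A ∣ ≟ k) (subsets n))))
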